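{- Let $G$ be a graph on $[n]$ such that $NC_G$ has a maximum element $\hat1$, and let $\unlhd$ be a total order on $E(G)$. Suppose that whenever $H<H'$ in $NC_G$ and $e=\min_{\unlhd}(E(H')\setminus E(H))$, the bond induced on $E(H)\cup\{e\}$ is noncrossing. Then, with NBC sets taken with respect to $\unlhd$: (a) $NC_G$ is graded with rank function $\rho(X)=n-cc(X)$. (b) The minimum labeling with respect to $\unlhd$ is an EL-labeling of $NC_G$, and so $NC_G$ is shellable. (c) For every $X\in NC_G$, the labels along any decreasing saturated chain from $\hat0$ to $X$ form a spanning noncrossing NBC set of $X$. (d) For every $X\in NC_G$, each spanning noncrossing NBC set of $X$ appears exactly once as the set of labels of a decreasing saturated chain from $\hat0$ to $X$. (e) For $H\in NC_G$, $\mu(H)=(-1)^{n-cc(H)}\mathrm{ncnbc}_{n-cc(H)}(H)$, and $\chi(NC_G,t)=\sum_{k\ge0}(-1)^k\mathrm{ncnbc}_k(G)\,t^{\rho(NC_G)-k}$.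
   Context: All graphs are finite simple graphs with vertex set $[n]=\{1,\dots,n\}$; edges are written $ij$ with $i<j$. Two edges $a_1a_2$ and $b_1b_2$ cross if $a_1<b_1<a_2<b_2$ or $b_1<a_1<b_2<a_2$. A spanning subgraph is identified with its edge set; $cc(X)$ is the number of connected components. A bond of $G$ is a spanning subgraph each of whose connected components is an induced subgraph of $G$; it is noncrossing if there are no two distinct components with vertex sets $B,B'$ and $a,c\in B$, $b,d\in B'$, $a<b<c<d$. $NC_G$ is the poset of noncrossing bonds ordered by inclusion of edge sets, with minimum $\hat0$ the empty bond. For $F\subseteq E(G)$, the bond induced on $F$ is the bond whose components are the induced subgraphs $G[C]$ where $C$ ranges over vertex sets of components of the spanning subgraph with edge set $F$. The minimum labeling assigns to a cover $H\lessdot H'$ the label $\min_{\unlhd}(E(H')\setminus E(H))$. An edge labeling is an EL-labeling if every interval has a unique increasing (strictly increasing labels) maximal chain and it lexicographically precedes all other maximal chains of the interval; a saturated chain is decreasing if its labels strictly decrease. A poset is shellable if its order complex is shellable. A broken circuit is the edge set of a cycle with its $\unlhd$-smallest edge removed; an NBC set contains no broken circuit; a noncrossing NBC set is an NBC set with no two crossing edges; a spanning noncrossing NBC set of $X\in NC_G$ is a noncrossing NBC set $S\subseteq E(X)$ whose spanning subgraph has the same connected-component vertex sets as $X$. $\mathrm{ncnbc}_k(X)$ is the number of noncrossing NBC sets of $X$ of size $k$. Möbius function: $\mu(\hat0)=1$, $\mu(x)=-\sum_{y<x}\mu(y)$; $\chi(P,t)=\sum_{x\in P}\mu(x)t^{\rho(P)-\rho(x)}$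 with $\rho(P)$ the rank of $P$. -}

module Defs where

open import Level using (0ℓ)
open import Function using (_∘_; flip)
open import Data.Bool.Base using (if_then_else_)
import Data.Bool.Properties as Bool
open import Data.Empty using (⊥-elim)
open import Data.Irrelevant using ([_])
open import Data.Refinement using (Refinement; value; _,_)
open import Data.Product using (_×_; _,_; proj₁; proj₂; ∃; ∃-syntax; uncurry)
open import Data.Sum using (_⊎_; inj₁; inj₂)
open import Data.Nat as ℕ using (ℕ; zero; suc; _∸_; z≤n; s≤s)
import Data.Nat.Properties as ℕ
open import Data.Integer as ℤ using (ℤ; 0ℤ; 1ℤ; -1ℤ; +_)
import Data.Integer.Properties as ℤ
open import Data.Fin as Fin using (Fin)
import Data.Fin.Properties as Fin
open import Data.Fin.Induction using (po-wellFounded)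
open import Data.Fin.Subset using
  (Subset; inside; outside; _∈_; _⊆_; _∪_; _─_; _-_; ⁅_⁆; ∣_∣; ⊥; ⊤; Nonempty)
open import Data.Fin.Subset.Properties using
  (_∈?_; _⊆?_; nonempty?; anySubset?; ⊆-antisym; ⊆-min; ∉⊥; x∈p∧x∉q⇒x∈p─q)
open import Data.Vec as Vec using ([]; _∷_)
import Data.Vec.Properties as Vec
open import Data.List as List using
  (List; []; _∷_; _++_; length; map; foldr; filter; zip; allFin; upTo; deduplicate)
open import Data.List.Extrema.Nat using (max)
import Data.List.Properties as List
open import Data.List.Membership.Propositional as List∈ using () renaming (_∈_ to _∈ˡ_)
open import Data.List.Membership.Propositional.Properties using
  (∈-allFin; ∈-filter⁺; ∈-filter⁻; ∈-map⁺; ∈-map⁻; ∈-++⁺ˡ; ∈-++⁺ʳ; ∈-lookup)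
open import Data.List.Relation.Binary.Lex.Strict using (Lex-<)
open import Data.List.Relation.Unary.All as All using (All; []; _∷_)
import Data.List.Relation.Unary.AllPairs as AllPairs
open import Data.List.Relation.Unary.Any as Any using (Any; here; there)
import Data.List.Relation.Unary.Any.Properties as Any
open import Data.List.Relation.Unary.Linked using (Linked)
open import Data.List.Relation.Unary.Unique.Propositional using (Unique; []; _∷_)
import Data.List.Relation.Unary.Unique.Propositional.Properties as Unique
open import Induction.WellFounded using (Acc; acc; WellFounded)
open import Relation.Binary.Core using (Rel)
open import Relation.Binary.Consequences using (total∧dec⇒dec)
open import Relation.Binary.Definitions using (Decidable; Minimum)
open import Relation.Binary.Structures using (IsDecPartialOrder; IsTotalOrder)
import Relation.Binary.Construct.NonStrictToStrict as ToStrict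
import Relation.Binary.Construct.On as On
open import Relation.Binary.Construct.Closure.ReflexiveTransitive as Star using
  (Star; ε; _◅_; _◅◅_)
open import Relation.Binary.PropositionalEquality using
  (_≡_; _≢_; refl; sym; trans; cong; cong₂; subst; isEquivalence)
open import Relation.Nullary using (Dec; yes; no; does; ¬_)
open import Relation.Nullary.Decidable using
  (map′; recompute; ¬?; _×-dec_; _⊎-dec_; _→-dec_)
open import Relation.Unary as U using (Pred)

------------------------------------------------------------------------
-- Finite sums, and polynomials

∑ : {A : Set} → List A → (A → ℤ) → ℤ
∑ xs f = foldr ℤ._+_ 0ℤ (map f xs)

-- A polynomial in t over ℤ is given by its coefficients: p i is the
-- coefficient of t^i.  Equality of polynomials is pointwise equality.
Poly : Set
Poly = ℕ → ℤ

monomial : ℤ → ℕ → Poly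
monomial c j i = if does (i ℕ.≟ j) then c else 0ℤ

∑ᵖ : {A : Set} → List A → (A → Poly) → Poly
∑ᵖ xs f i = ∑ xs (λ x → f x i)

------------------------------------------------------------------------
-- Finite sets of subsets

subsets : ∀ n → List (Subset n)
subsets zero    = [] ∷ []
subsets (suc n) = map (inside ∷_) (subsets n) ++ map (outside ∷_) (subsets n)

∈-subsets : ∀ {n} (S : Subset n) → S ∈ˡ subsets n
∈-subsets []            = here refl
∈-subsets (inside  ∷ S) = ∈-++⁺ˡ (∈-map⁺ (inside ∷_) (∈-subsets S))
∈-subsets (outside ∷ S) =
  ∈-++⁺ʳ (map (inside ∷_) (subsets _)) (∈-map⁺ (outside ∷_) (∈-subsets S))

subsets-unique : ∀ n → Unique (subsets n)
subsets-unique zero    = [] ∷ []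
subsets-unique (suc n) =
  Unique.++⁺ (Unique.map⁺ Vec.∷-injectiveʳ (subsets-unique n))
             (Unique.map⁺ Vec.∷-injectiveʳ (subsets-unique n))
             disjoint
  where
  disjoint : ∀ {S} → ¬ (S ∈ˡ map (inside ∷_) (subsets n) ×
                        S ∈ˡ map (outside ∷_) (subsets n))
  disjoint (p , q) with ∈-map⁻ _ p | ∈-map⁻ _ q
  ... | _ , _ , refl | _ , _ , ()

lookup-injective : ∀ {A : Set} {xs : List A} → Unique xs →
                   ∀ i j → List.lookup xs i ≡ List.lookup xs j → i ≡ j
lookup-injective (x≢ ∷ _) Fin.zero    Fin.zero    _  = refl
lookup-injective (x≢ ∷ _) Fin.zero    (Fin.suc j) eq = ⊥-elim (All.lookup x≢ (∈-lookup j) eq)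
lookup-injective (x≢ ∷ _) (Fin.suc i) Fin.zero    eq = ⊥-elim (All.lookup x≢ (∈-lookup i) (sym eq))
lookup-injective (_  ∷ u) (Fin.suc i) (Fin.suc j) eq = cong Fin.suc (lookup-injective u i j eq)

------------------------------------------------------------------------
-- Abstract simplicial complexes and shellability

-- A complex with vertices in Fin N, given by its set of faces.
Complex : ℕ → Set₁
Complex N = Pred (Subset N) 0ℓ

Facet : ∀ {N} → Complex N → Subset N → Set
Facet K F = K F × (∀ F′ → K F′ → F ⊆ F′ → F′ ≡ F)

-- The subcomplex of the simplex on F formed by the faces that also lie in
-- one of the simplices of prev.
_∩⋃_ : ∀ {N} → Subset N → List (Subset N) → Complex N
(F ∩⋃ prev) σ = σ ⊆ F × Any (σ ⊆_) prev

-- For every facet F but the first, F ∩⋃ (the earlier facets) is pure of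
-- dimension dim F - 1.  (For the first facet this subcomplex has no faces,
-- so the condition below is void.)
record IsShelling {N} (K : Complex N) (Fs : List (Subset N)) : Set where
  field
    distinct : Unique Fs
    facets   : ∀ {F} → F ∈ˡ Fs → Facet K F
    complete : ∀ {F} → Facet K F → F ∈ˡ Fs
    pure     : ∀ {prev F rest} → Fs ≡ prev ++ F ∷ rest →
               ∀ {σ} → Facet (F ∩⋃ prev) σ → suc ∣ σ ∣ ≡ ∣ F ∣

Shellable : ∀ {N} → Complex N → Set
Shellable K = ∃[ Fs ] IsShelling K Fs

------------------------------------------------------------------------
-- Finite posets

record FinitePoset : Set₁ where
  infix 4 _≤_
  field
    Carrier           : Set
    _≤_               : Rel Carrier 0ℓ
    isDecPartialOrder : IsDecPartialOrder _≡_ _≤_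
    elements          : List Carrier
    elements-complete : ∀ x → x ∈ˡ elements
    elements-unique   : Unique elements

  open IsDecPartialOrder isDecPartialOrder public
    using (_≟_; _≤?_; isPartialOrder)
  open ToStrict _≡_ _≤_ public using (_<_)

  infix 4 _⋖_ _<?_

  _<?_ : Decidable _<_
  _<?_ = ToStrict.<-decidable _≡_ _≤_ _≟_ _≤?_

  _⋖_ : Rel Carrier 0ℓ
  x ⋖ y = x < y × (∀ z → ¬ (x < z × z < y))

  <-wellFounded : WellFounded _<_
  <-wellFounded x = lift (po-wellFounded (On.isPartialOrder elt isPartialOrder) (index x))
                         (sym (Any.lookup-index (elements-complete x)))
    where
    elt : Fin (length elements) → Carrier
    elt = List.lookup elements
    index : Carrier → Fin (length elements)
    index y = Any.index (elements-complete y)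
    lift : ∀ {i y} → Acc (ToStrict._<_ (λ j k → elt j ≡ elt k) (λ j k → elt j ≤ elt k)) i →
           elt i ≡ y → Acc _<_ y
    lift (acc rs) refl = acc λ {z} z<y →
      let z≡ = Any.lookup-index (elements-complete z) in
      lift (rs (subst (_< _) z≡ z<y)) (sym z≡)

module _ (P : FinitePoset) where
  open FinitePoset P

  -- Saturated chains from x to y, which are the maximal chains of [x , y].
  -- The cover proofs are irrelevant, so that two chains are equal as soon as
  -- they have the same elements.
  data SaturatedChain : Carrier → Carrier → Set where
    ⟨_⟩    : ∀ x → SaturatedChain x x
    _⋖⟨_⟩_ : ∀ x {y z} → .(x ⋖ y) → SaturatedChain y z → SaturatedChain x z

  chainLength : ∀ {x y} → SaturatedChain x y → ℕ
  chainLength ⟨ _ ⟩        = 0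
  chainLength (_ ⋖⟨ _ ⟩ c) = suc (chainLength c)

  Minimal Maximal : Carrier → Set
  Minimal x = ∀ y → ¬ y < x
  Maximal x = ∀ y → ¬ x < y

  record GradedWithRank (ρ : Carrier → ℕ) : Set where
    field
      pure         : ∀ {x y x′ y′} →
                     Minimal x → Maximal y → Minimal x′ → Maximal y′ →
                     (c : SaturatedChain x y) (c′ : SaturatedChain x′ y′) →
                     chainLength c ≡ chainLength c′
      rank-minimal : ∀ {x} → Minimal x → ρ x ≡ 0
      rank-cover   : ∀ {x y} → x ⋖ y → ρ y ≡ suc (ρ x)

  posetRank : (Carrier → ℕ) → ℕ
  posetRank ρ = max 0 (map ρ elements)

  EdgeLabeling : Set → Set
  EdgeLabeling Λ = ∀ x y → .(x ⋖ y) → Λ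

  module _ {Λ : Set} (ℓ : EdgeLabeling Λ) where

    labels : ∀ {x y} → SaturatedChain x y → List Λ
    labels ⟨ _ ⟩                  = []
    labels (_⋖⟨_⟩_ x {y} x⋖y c) = ℓ x y x⋖y ∷ labels c

    module _ (_≺_ : Rel Λ 0ℓ) where

      Increasing Decreasing : ∀ {x y} → SaturatedChain x y → Set
      Increasing c = Linked _≺_ (labels c)
      Decreasing c = Linked (flip _≺_) (labels c)

      IsELLabeling : Set
      IsELLabeling = ∀ {x y} → x ≤ y →
        ∃[ c ] Increasing {x} {y} c
             × (∀ d → Increasing d → d ≡ c)
             × (∀ d → d ≢ c → Lex-< _≡_ _≺_ (labels c) (labels d))

  -- The order complex: its vertices are (the positions of) the elements of P
  -- and its faces are the chains of P.
  orderComplex : Complex (length elements)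
  orderComplex σ = ∀ {i j} → i ∈ σ → j ∈ σ →
    let x = List.lookup elements i
        y = List.lookup elements j
    in  x ≤ y ⊎ y ≤ x

  -- The Möbius function of a poset with minimum 0̂.
  module Möbius (0̂ : Carrier) where

    μ-acc   : ∀ x → Acc _<_ x → ℤ
    μ-below : ∀ {x} → (∀ {y} → y < x → Acc _<_ y) → ∀ y → Dec (y < x) → ℤ

    μ-acc x (acc rs) =
      if does (x ≟ 0̂) then 1ℤ else ℤ.- ∑ elements (λ y → μ-below rs y (y <? x))

    μ-below rs y (yes y<x) = μ-acc y (rs y<x)
    μ-below rs y (no  _)   = 0ℤ

    μ : Carrier → ℤ
    μ x = μ-acc x (<-wellFounded x)

    characteristicPolynomial : (ρ : Carrier → ℕ) → Poly
    characteristicPolynomial ρ =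
      ∑ᵖ elements (λ x → monomial (μ x) (posetRank ρ ∸ ρ x))

    μ-acc-irrelevant : ∀ x (p q : Acc _<_ x) → μ-acc x p ≡ μ-acc x q
    μ-acc-irrelevant x (acc rs) (acc rs′) with x ≟ 0̂
    ... | yes _ = refl
    ... | no  _ = cong ℤ.-_ (go elements)
      where
      go : ∀ ys → ∑ ys (λ y → μ-below rs y (y <? x)) ≡ ∑ ys (λ y → μ-below rs′ y (y <? x))
      go []       = refl
      go (y ∷ ys) with y <? x
      ... | yes y<x = cong₂ ℤ._+_ (μ-acc-irrelevant y (rs y<x) (rs′ y<x)) (go ys)
      ... | no  _   = cong (λ z → 0ℤ ℤ.+ z) (go ys)

    μ-0̂ : μ 0̂ ≡ 1ℤ
    μ-0̂ with <-wellFounded 0̂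
    ... | acc rs with 0̂ ≟ 0̂
    ...   | yes _   = refl
    ...   | no  0̂≢0̂ = ⊥-elim (0̂≢0̂ refl)

    μ-rec : ∀ {x} → x ≢ 0̂ → μ x ≡ ℤ.- ∑ (filter (_<? x) elements) μ
    μ-rec {x} x≢0̂ with <-wellFounded x
    ... | acc rs with x ≟ 0̂
    ...   | yes x≡0̂ = ⊥-elim (x≢0̂ x≡0̂)
    ...   | no  _   = cong ℤ.-_ (go elements)
      where
      go : ∀ ys → ∑ ys (λ y → μ-below rs y (y <? x)) ≡ ∑ (filter (_<? x) ys) μ
      go []       = refl
      go (y ∷ ys) with y <? x
      ... | yes y<x = trans (cong₂ ℤ._+_ (μ-acc-irrelevant y (rs y<x) (<-wellFounded y)) (go ys))
                            (cong (λ zs → ∑ zs μ) (sym (List.filter-accept (_<? x) y<x)))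
      ... | no  y≮x = trans (trans (ℤ.+-identityˡ _) (go ys))
                            (cong (λ zs → ∑ zs μ) (sym (List.filter-reject (_<? x) y≮x)))

------------------------------------------------------------------------
-- Graphs

-- A finite simple graph on the linearly ordered vertex set Fin n, given by an
-- enumeration without repetition of its edges ij (i < j).  Sets of edges, and
-- hence spanning subgraphs, are then elements of Subset size.
record Graph (n : ℕ) : Set where
  field
    size   : ℕ
    lo hi  : Fin size → Fin n
    lo<hi  : ∀ e → lo e Fin.< hi e
    simple : ∀ {e f} → lo e ≡ lo f → hi e ≡ hi f → e ≡ f

module GraphNotions {n : ℕ} (G : Graph n) where
  open Graph G

  Edge Subgraph : Set
  Edge     = Fin size
  Subgraph = Subset size

  Joins : Edge → Fin n → Fin n → Set
  Joins e u v = (lo e ≡ u × hi e ≡ v) ⊎ (lo e ≡ v × hi e ≡ u)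

  Adjacent : Subgraph → Rel (Fin n) 0ℓ
  Adjacent X u v = ∃[ e ] (e ∈ X × Joins e u v)

  Connected : Subgraph → Rel (Fin n) 0ℓ
  Connected X = Star (Adjacent X)

  Crossing : Edge → Edge → Set
  Crossing e f = (lo e Fin.< lo f × lo f Fin.< hi e × hi e Fin.< hi f)
               ⊎ (lo f Fin.< lo e × lo e Fin.< hi f × hi f Fin.< hi e)

  joins? : ∀ e → Decidable (Joins e)
  joins? e u v = ((lo e Fin.≟ u) ×-dec (hi e Fin.≟ v))
           ⊎-dec ((lo e Fin.≟ v) ×-dec (hi e Fin.≟ u))

  adjacent? : ∀ X → Decidable (Adjacent X)
  adjacent? X u v = Fin.any? λ e → (e ∈? X) ×-dec joins? e u v

  crossing? : Decidable Crossing
  crossing? e f =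
          ((lo e Fin.<? lo f) ×-dec (lo f Fin.<? hi e) ×-dec (hi e Fin.<? hi f))
    ⊎-dec ((lo f Fin.<? lo e) ×-dec (lo e Fin.<? hi f) ×-dec (hi f Fin.<? hi e))

  private
    AdjacentBy : List Edge → Rel (Fin n) 0ℓ
    AdjacentBy es u v = Any (λ e → Joins e u v) es

    -- A walk using e ∷ es either avoids e or can be made to use e just once.
    connectedBy? : ∀ es → Decidable (Star (AdjacentBy es))
    connectedBy? []       u v = map′ (λ { refl → ε }) (λ { ε → refl ; (() ◅ _) }) (u Fin.≟ v)
    connectedBy? (e ∷ es) u v = map′ to from
      (connectedBy? es u v
        ⊎-dec ((connectedBy? es u (lo e) ×-dec connectedBy? es (hi e) v)
        ⊎-dec  (connectedBy? es u (hi e) ×-dec connectedBy? es (lo e) v)))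
      where
      C = Star (AdjacentBy es)
      Split : Fin n → Fin n → Set
      Split u v = C u v ⊎ ((C u (lo e) × C (hi e) v) ⊎ (C u (hi e) × C (lo e) v))
      weaken : ∀ {u v} → C u v → Star (AdjacentBy (e ∷ es)) u v
      weaken = Star.map there
      to : ∀ {u v} → Split u v → Star (AdjacentBy (e ∷ es)) u v
      to (inj₁ p)              = weaken p
      to (inj₂ (inj₁ (p , q))) = weaken p ◅◅ here (inj₁ (refl , refl)) ◅ weaken q
      to (inj₂ (inj₂ (p , q))) = weaken p ◅◅ here (inj₂ (refl , refl)) ◅ weaken q
      from : ∀ {u v} → Star (AdjacentBy (e ∷ es)) u v → Split u v
      from ε = inj₁ ε
      from (there a ◅ s) with from s
      ... | inj₁ p              = inj₁ (a ◅ p)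
      ... | inj₂ (inj₁ (p , q)) = inj₂ (inj₁ (a ◅ p , q))
      ... | inj₂ (inj₂ (p , q)) = inj₂ (inj₂ (a ◅ p , q))
      from (here (inj₁ (refl , refl)) ◅ s) with from s
      ... | inj₁ p              = inj₂ (inj₁ (ε , p))
      ... | inj₂ (inj₁ (_ , q)) = inj₂ (inj₁ (ε , q))
      ... | inj₂ (inj₂ (_ , q)) = inj₁ q
      from (here (inj₂ (refl , refl)) ◅ s) with from s
      ... | inj₁ p              = inj₂ (inj₂ (ε , p))
      ... | inj₂ (inj₁ (_ , q)) = inj₁ q
      ... | inj₂ (inj₂ (_ , q)) = inj₂ (inj₂ (ε , q))

  connected? : ∀ X → Decidable (Connected X)
  connected? X u v = map′ (Star.map to) (Star.map from) (connectedBy? edgeList u v)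
    where
    edgeList : List Edge
    edgeList = filter (_∈? X) (allFin size)
    to : ∀ {u v} → AdjacentBy edgeList u v → Adjacent X u v
    to a with List∈.find a
    ... | e , e∈ , j = e , proj₂ (∈-filter⁻ (_∈? X) {xs = allFin size} e∈) , j
    from : ∀ {u v} → Adjacent X u v → AdjacentBy edgeList u v
    from (e , e∈X , j) = List∈.lose (∈-filter⁺ (_∈? X) (∈-allFin e) e∈X) j

  component : Subgraph → Fin n → Subset n
  component X v = Vec.tabulate λ u → does (connected? X v u)

  cc : Subgraph → ℕ
  cc X = length (deduplicate (Vec.≡-dec Bool._≟_) (map (component X) (allFin n)))

  inducedBond : Subgraph → Subgraph
  inducedBond F = Vec.tabulate λ e → does (connected? F (lo e) (hi e))

  -- Every edge of G with both ends in the component of v belongs to X.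
  IsBond : Subgraph → Set
  IsBond X = ∀ v e → Connected X v (lo e) → Connected X v (hi e) → e ∈ X

  -- This concerns the vertex sets of components, not the crossing of edges.
  Noncrossing : Subgraph → Set
  Noncrossing X = ∀ a b c d →
    ¬ (a Fin.< b × b Fin.< c × c Fin.< d ×
       Connected X a c × Connected X b d × ¬ Connected X a b)

  IsNoncrossingBond : Subgraph → Set
  IsNoncrossingBond X = IsBond X × Noncrossing X

  isNoncrossingBond? : U.Decidable IsNoncrossingBond
  isNoncrossingBond? X =
          (Fin.all? λ v → Fin.all? λ e →
             connected? X v (lo e) →-dec (connected? X v (hi e) →-dec (e ∈? X)))
    ×-dec (Fin.all? λ a → Fin.all? λ b → Fin.all? λ c → Fin.all? λ d → ¬?
             ((a Fin.<? b) ×-dec (b Fin.<? c) ×-dec (c Fin.<? d) ×-dec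
              connected? X a c ×-dec connected? X b d ×-dec ¬? (connected? X a b)))

  -- The membership proof is irrelevant, so that noncrossing bonds are equal
  -- as soon as their edge sets are.
  NoncrossingBond : Set
  NoncrossingBond = Refinement Subgraph IsNoncrossingBond

  E : NoncrossingBond → Subgraph
  E = value

  E-injective : ∀ {H H′} → E H ≡ E H′ → H ≡ H′
  E-injective refl = refl

  private
    collect : List Subgraph → List NoncrossingBond
    collect []       = []
    collect (X ∷ Xs) with isNoncrossingBond? X
    ... | yes p = (X , [ p ]) ∷ collect Xs
    ... | no  _ = collect Xs

    ∈-collect : ∀ Xs H → E H ∈ˡ Xs → H ∈ˡ collect Xs
    ∈-collect (X ∷ Xs) H@(_ , [ h ]) (here refl) with isNoncrossingBond? X
    ... | yes _ = here refl
    ... | no ¬p = ⊥-elim (¬p (recompute (isNoncrossingBond? X) h))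
    ∈-collect (X ∷ Xs) H (there H∈) with isNoncrossingBond? X
    ... | yes _ = there (∈-collect Xs H H∈)
    ... | no  _ = ∈-collect Xs H H∈

    collect-All : ∀ {P : Pred Subgraph 0ℓ} {Xs} → All P Xs → All (P ∘ E) (collect Xs)
    collect-All []                 = []
    collect-All {Xs = X ∷ _} (p ∷ ps) with isNoncrossingBond? X
    ... | yes _ = p ∷ collect-All ps
    ... | no  _ = collect-All ps

    collect-unique : ∀ {Xs} → Unique Xs → Unique (collect Xs)
    collect-unique []                 = []
    collect-unique {X ∷ _} (x ∷ xs) with isNoncrossingBond? X
    ... | yes _ = All.map (λ X≢ → X≢ ∘ cong E) (collect-All x) ∷ collect-unique xs
    ... | no  _ = collect-unique xs

  NC : FinitePoset
  NC = record
    { Carrier           = NoncrossingBond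
    ; _≤_               = λ H H′ → E H ⊆ E H′
    ; isDecPartialOrder = record
      { isPartialOrder = record
        { isPreorder = record
          { isEquivalence = isEquivalence
          ; reflexive     = λ { refl e∈ → e∈ }
          ; trans         = λ p q → q ∘ p
          }
        ; antisym = λ p q → E-injective (⊆-antisym p q)
        }
      ; _≟_  = λ H H′ → map′ E-injective (cong E) (Vec.≡-dec Bool._≟_ (E H) (E H′))
      ; _≤?_ = λ H H′ → E H ⊆? E H′
      }
    ; elements          = collect (subsets size)
    ; elements-complete = λ H → ∈-collect (subsets size) H (∈-subsets (E H))
    ; elements-unique   = collect-unique (subsets-unique size)
    }

  private
    connected-⊥ : ∀ {u v} → Connected ⊥ u v → u ≡ v
    connected-⊥ ε                   = refl
    connected-⊥ ((_ , e∈⊥ , _) ◅ _) = ⊥-elim (∉⊥ e∈⊥)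

  0̂ : NoncrossingBond
  0̂ = ⊥ , [ (λ v e p q → ⊥-elim (Fin.<-irrefl (trans (sym (connected-⊥ p)) (connected-⊥ q)) (lo<hi e)))
          , (λ { a b c d (a<b , b<c , _ , a~c , _) →
                 Fin.<-irrefl (connected-⊥ a~c) (Fin.<-trans a<b b<c) }) ]

  0̂-minimum : Minimum (FinitePoset._≤_ NC) 0̂
  0̂-minimum H = ⊆-min (E H)

  -- n - cc X; the subtraction is not truncated, as cc X ≤ n.
  ρ : NoncrossingBond → ℕ
  ρ X = n ∸ cc (E X)

  -- The consecutive pairs of the closed walk v, v₁, …, vₖ, v.
  steps : Fin n → List (Fin n) → List (Fin n × Fin n)
  steps v vs = zip (v ∷ vs) (vs ++ v ∷ [])

  -- C is the edge set of a cycle through distinct vertices v, v₁, …, vₖ (k ≥ 2).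
  IsCycleThrough : Subgraph → Fin n → List (Fin n) → Set
  IsCycleThrough C v vs =
    Unique (v ∷ vs) × 2 ℕ.≤ length vs ×
    All (uncurry (Adjacent C)) (steps v vs) ×
    (∀ e → e ∈ C → Any (uncurry (Joins e)) (steps v vs))

  IsCycle : Subgraph → Set
  IsCycle C = ∃[ v ] ∃[ vs ] IsCycleThrough C v vs

  isCycle? : U.Decidable IsCycle
  isCycle? C = Fin.any? λ v → map′ (λ { (vs , _ , p) → vs , p })
                                   (λ { (vs , p) → vs , bound vs p , p })
                                   (anyList? n (through? v))
    where
    through? : ∀ v → U.Decidable (IsCycleThrough C v)
    through? v vs =
            AllPairs.allPairs? (λ x y → ¬? (x Fin.≟ y)) (v ∷ vs)
      ×-dec (2 ℕ.≤? length vs)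
      ×-dec All.all? (λ (a , b) → adjacent? C a b) (steps v vs)
      ×-dec Fin.all? (λ e → (e ∈? C) →-dec Any.any? (λ (a , b) → joins? e a b) (steps v vs))
    bound : ∀ {v} vs → IsCycleThrough C v vs → length vs ℕ.≤ n
    bound vs (uniq , _) = ℕ.<⇒≤ (Fin.injective⇒≤ (λ {i} {j} → lookup-injective uniq i j))
    anyList? : ∀ {Q : Pred (List (Fin n)) 0ℓ} k → U.Decidable Q →
               Dec (∃[ vs ] (length vs ℕ.≤ k × Q vs))
    anyList? zero    Q? = map′ (λ q → [] , z≤n , q) (λ { ([] , _ , q) → q }) (Q? [])
    anyList? (suc k) Q? =
      map′ (λ { (inj₁ q)                  → [] , z≤n , q
              ; (inj₂ (v , vs , vs≤k , q)) → v ∷ vs , s≤s vs≤k , q })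
           (λ { ([] , _ , q)              → inj₁ q
              ; (v ∷ vs , s≤s vs≤k , q)   → inj₂ (v , vs , vs≤k , q) })
           (Q? [] ⊎-dec Fin.any? λ v → anyList? k (Q? ∘ (v ∷_)))

------------------------------------------------------------------------
-- Graphs with a total order on the edges

module OrderedGraph {n : ℕ} (G : Graph n) (_⊴_ : Rel (GraphNotions.Edge G) 0ℓ)
                    (isTotalOrder : IsTotalOrder _≡_ _⊴_) where
  open Graph G
  open GraphNotions G public
  open ToStrict _≡_ _⊴_ public using () renaming (_<_ to _◁_)
  open FinitePoset NC public using (_≤_; _<_)
  private module ⊴ = IsTotalOrder isTotalOrder

  Least : Subgraph → Edge → Set
  Least S e = e ∈ S × (∀ f → f ∈ S → e ⊴ f)

  least? : ∀ S → U.Decidable (Least S)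
  least? S e = (e ∈? S) ×-dec Fin.all? λ f → (f ∈? S) →-dec (e ⊴? f)
    where
    _⊴?_ : Decidable _⊴_
    _⊴?_ = total∧dec⇒dec ⊴.reflexive ⊴.antisym ⊴.total Fin._≟_

  least : ∀ S → Nonempty S → ∃ (Least S)
  least S (e₀ , e₀∈S) =
    let e , e∈S , e⊴ = go (allFin size) in e , e∈S , λ f → e⊴ f (∈-allFin f)
    where
    go : ∀ es → ∃[ e ] (e ∈ S × (∀ f → f ∈ˡ es → f ∈ S → e ⊴ f))
    go []       = e₀ , e₀∈S , λ _ ()
    go (g ∷ es) with go es | g ∈? S
    ... | e , e∈S , e⊴ | no g∉S =
      e , e∈S , λ { f (here refl) f∈S → ⊥-elim (g∉S f∈S) ; f (there f∈) → e⊴ f f∈ }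
    ... | e , e∈S , e⊴ | yes g∈S with ⊴.total e g
    ...   | inj₁ e⊴g = e , e∈S , λ { f (here refl) _ → e⊴g ; f (there f∈) → e⊴ f f∈ }
    ...   | inj₂ g⊴e = g , g∈S , λ { f (here refl) _ → ⊴.refl
                                   ; f (there f∈) f∈S → ⊴.trans g⊴e (e⊴ f f∈ f∈S) }

  minEdge : ∀ S → .(Nonempty S) → Edge
  minEdge S ne = proj₁ (least S (recompute (nonempty? S) ne))

  <⇒─-nonempty : ∀ {H H′} → H < H′ → Nonempty (E H′ ─ E H)
  <⇒─-nonempty {H} {H′} (H≤H′ , H≢H′) with nonempty? (E H′ ─ E H)
  ... | yes ne = ne
  ... | no ¬ne = ⊥-elim (H≢H′ (NC.antisym H≤H′ H′≤H))
    where
    module NC = IsDecPartialOrder (FinitePoset.isDecPartialOrder NC)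
    H′≤H : E H′ ⊆ E H
    H′≤H {e} e∈H′ with e ∈? E H
    ... | yes e∈H = e∈H
    ... | no  e∉H = ⊥-elim (¬ne (e , x∈p∧x∉q⇒x∈p─q e∈H′ e∉H))

  minimumLabeling : EdgeLabeling NC Edge
  minimumLabeling H H′ H⋖H′ = minEdge (E H′ ─ E H) (<⇒─-nonempty {H} {H′} (proj₁ H⋖H′))

  labelSet : ∀ {H H′} → SaturatedChain NC H H′ → Subgraph
  labelSet c = foldr (λ e S → ⁅ e ⁆ ∪ S) ⊥ (labels NC minimumLabeling c)

  IsBrokenCircuit : Subgraph → Subgraph → Set
  IsBrokenCircuit X B = ∃[ C ] (IsCycle C × C ⊆ X × ∃[ e ] (Least C e × B ≡ C - e))

  IsNBC : Subgraph → Subgraph → Set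
  IsNBC X S = S ⊆ X × ¬ (∃[ B ] (IsBrokenCircuit X B × B ⊆ S))

  IsNoncrossingNBC : Subgraph → Subgraph → Set
  IsNoncrossingNBC X S = IsNBC X S × (∀ e f → e ∈ S → f ∈ S → ¬ Crossing e f)

  IsSpanningNoncrossingNBC : Subgraph → Subgraph → Set
  IsSpanningNoncrossingNBC X S =
    IsNoncrossingNBC X S × (∀ v → component S v ≡ component X v)

  isBrokenCircuit? : Decidable IsBrokenCircuit
  isBrokenCircuit? X B = anySubset? λ C → isCycle? C ×-dec (C ⊆? X) ×-dec
    Fin.any? λ e → least? C e ×-dec Vec.≡-dec Bool._≟_ B (C - e)

  isNoncrossingNBC? : Decidable IsNoncrossingNBC
  isNoncrossingNBC? X S =
    ((S ⊆? X) ×-dec ¬? (anySubset? λ B → isBrokenCircuit? X B ×-dec (B ⊆? S)))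
    ×-dec Fin.all? λ e → Fin.all? λ f →
            (e ∈? S) →-dec ((f ∈? S) →-dec ¬? (crossing? e f))

  ncnbc : ℕ → Subgraph → ℕ
  ncnbc k X =
    length (filter (λ S → (∣ S ∣ ℕ.≟ k) ×-dec isNoncrossingNBC? X S) (subsets size))

  open Möbius NC 0̂ public using (μ)

  χ : Poly
  χ = Möbius.characteristicPolynomial NC 0̂ ρ

  -- ∑_{k ≥ 0} (-1)^k ncnbc_k(G) t^{ρ(NC_G) - k}.  The range 0 ≤ k ≤ |E(G)|
  -- exhausts the sizes of sets of edges, and NBC sets, being forests, have at
  -- most n - cc(G) elements, so the subtraction truncates only in zero terms.
  ncnbcPolynomial : Poly
  ncnbcPolynomial = ∑ᵖ (upTo (suc size)) λ k →
    monomial (-1ℤ ℤ.^ k ℤ.* + ncnbc k ⊤) (posetRank NC ρ ∸ k)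

{-# OPTIONS --safe #-}
module Submission where

-- Write e for the least edge of H′ ∖ H.  The hypothesis makes the bond induced
-- on H ∪ e an element between H and H′ with one component less than H; hence
-- covers merge two components, and the labels of a chain determine the chain.
-- Following the least missing edge at each step gives the increasing chain,
-- and a chain whose first label is not the least has a descent that can be
-- replaced by a lexicographically smaller step, which yields the shelling.
--
-- The least edge of a noncrossing bond X crosses no edge of X (apply the
-- hypothesis to the bond consisting of a single edge) and lies in no broken
-- circuit of X; it is also the least edge of every spanning NBC set of X, so
-- removing it undoes the last step of a decreasing chain.  The noncrossing NBC
-- sets of X form a cone over it, and so their signed count vanishes unless X is
-- empty.  Each such set spans exactly one noncrossing bond below X, whose rank
-- is its size, so the signed numbers of spanning sets satisfy the recursion of
-- the Möbius function.

open import Defs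
open import Level using (0ℓ)
open import Function using (_∘_; flip)
open import Function.Bundles using (mk⇔)
import Data.Bool.Properties as Bool
open import Data.Empty using (⊥-elim)
open import Data.Product using (_×_; _,_; proj₁; proj₂; ∃; ∃-syntax; uncurry; ∃!)
open import Data.Sum using (_⊎_; inj₁; inj₂; [_,_]′)
open import Data.Nat as ℕ using (ℕ; zero; suc; _∸_; z≤n; s≤s)
import Data.Nat.Properties as ℕ
open import Data.Fin as Fin using (Fin)
import Data.Fin.Properties as Fin
open import Data.Fin.Subset using (Subset; inside; outside; _∈_; _∉_; _⊆_; _∪_; _─_; _-_; ⁅_⁆;
  ∣_∣; ⊥; ⊤; Nonempty)
open import Data.Fin.Subset.Properties using (_∈?_; ⊆-antisym; ∉⊥; x∈p∪q⁻; x∈p∪q⁺; p⊆p∪q; q⊆p∪q;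
  x∈⁅x⁆; x∈⁅y⁆⇒x≡y; p─⊥≡p; p─q⊆p; x∈p∧x≢y⇒x∈p-y; ⊆⊤; x∈p∧x∉q⇒x∈p─q; nonempty?; Empty-unique;
  ∣⊥∣≡0; ∪-assoc; ∪-identityˡ; ∪-identityʳ; ⊆-min; ∣p∣≤n)
open import Data.Vec as Vec using ([]; _∷_; _[_]≔_)
import Data.Vec.Properties as Vec
open import Data.List as List using (List; []; _∷_; _++_; length; map; zip; filter; allFin;
  deduplicate; foldr; upTo)
import Data.List.Properties as List
open import Data.List.Membership.Propositional using (find; lose) renaming (_∈_ to _∈ˡ_; _∉_ to
  _∉ˡ_)
open import Data.List.Membership.Propositional.Properties using (∈-map⁺; ∈-map⁻; ∈-allFin;
  ∈-deduplicate⁺; ∈-deduplicate⁻; ∈-++⁺ˡ; ∈-++⁺ʳ; ∈-++⁻; ∈-concatMap⁺; ∈-upTo⁺)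
open import Data.List.Relation.Unary.All as All using (All; []; _∷_)
open import Data.List.Relation.Unary.Any as Any using (here; there; Any)
open import Data.List.Relation.Unary.Unique.Propositional using (Unique)
import Data.List.Relation.Unary.Unique.Propositional.Properties as Unique
open import Data.List.Relation.Unary.Unique.DecPropositional.Properties using (deduplicate-!)
open import Data.List.Relation.Binary.Permutation.Propositional.Properties using (↭-length;
  ∈-resp-↭)
open import Data.List.Relation.Binary.BagAndSetEquality using (∼bag⇒↭)
open import Data.List.Membership.Propositional.Properties.WithK using (unique∧set⇒bag)
open import Relation.Binary.Core using (Rel)
open import Relation.Binary.Construct.Closure.ReflexiveTransitive as Star using (Star; ε; _◅_; _◅◅_)
open import Relation.Binary.PropositionalEquality using (_≡_; _≢_; refl; sym; trans; cong;
  cong₂; subst; module ≡-Reasoning; subst₂; setoid; _≗_)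
open import Relation.Nullary using (Dec; yes; no; does; ¬_)
open import Relation.Nullary.Decidable using (dec-true; recompute; _×-dec_; map′; ¬?)
open import Relation.Unary using (Pred; Decidable)
open import Data.List.Membership.DecPropositional using () renaming (_∈?_ to ∈ˡ-dec)
open import Data.List.Relation.Unary.All.Properties using (¬Any⇒All¬; All¬⇒¬Any)
open import Relation.Binary.Definitions using (tri<; tri≈; tri>; Maximum; Minimum; Irreflexive;
  Asymmetric) renaming (Decidable to Decidable₂)
open import Data.Irrelevant using ([_])
import Data.Refinement as Refinement
open import Relation.Binary.Structures using (IsTotalOrder; IsStrictTotalOrder; IsDecPartialOrder)
import Relation.Binary.Construct.NonStrictToStrict as ToStrict
open import Data.List.Relation.Unary.AllPairs as AllPairs using (AllPairs; []; _∷_)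
open import Data.List.Relation.Unary.Linked as Linked using (Linked; []; [-]; _∷_)
open import Data.List.Relation.Unary.Linked.Properties using (Linked⇒AllPairs)
open import Data.List.Relation.Binary.Lex.Strict as Lex using (Lex-<; base; halt; this; next)
import Data.List.Relation.Unary.Any.Properties as Any
import Data.List.Sort as Sort
open import Data.List.Relation.Binary.Pointwise using (Pointwise-≡⇒≡; ≡⇒Pointwise-≡)
import Relation.Binary.Construct.On as On
open import Relation.Binary.Bundles using (DecTotalOrder)
open import Data.List.Relation.Binary.Permutation.Propositional using (↭-sym; ↭⇒↭ₛ)
import Data.List.Relation.Binary.Permutation.Setoid.Properties as SetoidPerm
open import Data.Bool.Base using (if_then_else_)
open import Data.Integer as ℤ using (ℤ; 0ℤ; 1ℤ; -1ℤ; +_; _*_; _^_)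
import Data.Integer.Properties as ℤ
open import Algebra.Properties.CommutativeSemigroup ℤ.+-commutativeSemigroup using (interchange)
open import Algebra.Properties.AbelianGroup ℤ.+-0-abelianGroup using (inverseʳ-unique)
open import Induction.WellFounded using (Acc; acc)

-- Membership in the poset has two sources. Going up from a bond, the hypothesis on the order shows
-- that the enlarged bond is noncrossing. Going down from a spanning set S, or passing from any
-- noncrossing NBC set to the bond it spans, no least new edge is at hand; there the planar fact
-- that pairwise noncrossing edges have noncrossing components takes over
-- (`NoncrossingEdges⇒Noncrossing`). All ranks are measured by `cc`. Joining two components lowers
-- it by one, it drops strictly along `<`, and NBC sets are forests, so ∣S∣ + cc S = n. Thus `x ≤ y`
-- with counts differing by one is already a cover, and recursion on `cc` replaces recursion on
-- chains. The shelling order is the lexicographic order of the label words of maximal chains. What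
-- has to be found is, for a chain preceded by another one, an element outside the latter whose
-- removal leaves a subset of some earlier chain; a descent provides it. The Möbius values and χ
-- come from one double count of pairs (y , S) with an arbitrary weight depending on ∣S∣.

unique-set⇒length≡ : ∀ {A : Set} {xs ys : List A} → Unique xs → Unique ys →
                     (∀ {x} → x ∈ˡ xs → x ∈ˡ ys) → (∀ {x} → x ∈ˡ ys → x ∈ˡ xs) →
                     length xs ≡ length ys
unique-set⇒length≡ u v to from = ↭-length (∼bag⇒↭ (unique∧set⇒bag u v (mk⇔ to from)))

-- Injectivity is asked only on the list, because the map `shrink` used in counting components
-- identifies all vertex sets that contain `lo e`.
unique-map-on : ∀ {A B : Set} (f : A → B) {xs} →
                (∀ {x y} → x ∈ˡ xs → y ∈ˡ xs → f x ≡ f y → x ≡ y) →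
                Unique xs → Unique (map f xs)
unique-map-on f inj []       = []
unique-map-on f {x ∷ xs} inj (x≢ ∷ u) =
  All.tabulate fx≢ ∷ unique-map-on f (λ p q → inj (there p) (there q)) u
  where
  fx≢ : ∀ {b} → b ∈ˡ map f xs → f x ≢ b
  fx≢ b∈ fx≡b with ∈-map⁻ f b∈
  ... | y , y∈ , refl = All.lookup x≢ y∈ (inj (here refl) (there y∈) fx≡b)

-- Finite subsets given by decidable predicates, and removal of elements.

module _ {m : ℕ} where

  module _ {P : Pred (Fin m) 0ℓ} (P? : Decidable P) where

    ∈-tabulate⁺ : ∀ {i} → P i → i ∈ Vec.tabulate (does ∘ P?)
    ∈-tabulate⁺ {i} p = Vec.lookup⇒[]= i _ (trans (Vec.lookup∘tabulate _ i) (dec-true (P? i) p))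

    ∈-tabulate⁻ : ∀ {i} → i ∈ Vec.tabulate (does ∘ P?) → P i
    ∈-tabulate⁻ {i} i∈ with P? i | trans (sym (Vec.lookup∘tabulate (does ∘ P?) i)) (Vec.[]=⇒lookup i∈)
    ... | yes p | _  = p
    ... | no  _ | ()

  ∈∪⁅⁆⁻ : ∀ {S : Subset m} {x y} → y ∈ S ∪ ⁅ x ⁆ → y ∈ S ⊎ y ≡ x
  ∈∪⁅⁆⁻ {S} {x} y∈ with x∈p∪q⁻ S ⁅ x ⁆ y∈
  ... | inj₁ y∈S = inj₁ y∈S
  ... | inj₂ y∈x = inj₂ (x∈⁅y⁆⇒x≡y x y∈x)

  ∈∪⁅⁆ˡ : ∀ {S : Subset m} x → S ⊆ S ∪ ⁅ x ⁆
  ∈∪⁅⁆ˡ x = p⊆p∪q ⁅ x ⁆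

  ∈∪⁅⁆ʳ : ∀ (S : Subset m) x → x ∈ S ∪ ⁅ x ⁆
  ∈∪⁅⁆ʳ S x = q⊆p∪q S ⁅ x ⁆ (x∈⁅x⁆ x)

∈─⁻ : ∀ {m} (p q : Subset m) {x} → x ∈ p ─ q → x ∈ p × x ∉ q
∈─⁻ (inside ∷ p) (outside ∷ q) Vec.here       = Vec.here , λ ()
∈─⁻ (s ∷ p)      (inside ∷ q)  (Vec.there x∈) =
  let a , b = ∈─⁻ p q x∈ in Vec.there a , λ { (Vec.there c) → b c }
∈─⁻ (s ∷ p)      (outside ∷ q) (Vec.there x∈) =
  let a , b = ∈─⁻ p q x∈ in Vec.there a , λ { (Vec.there c) → b c }

module _ {m : ℕ} where

  ∈-⁻ : ∀ {S : Subset m} {x y} → y ∈ S - x → y ∈ S × y ≢ x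
  ∈-⁻ {S} {x} y∈ = let y∈S , y∉x = ∈─⁻ S ⁅ x ⁆ y∈ in y∈S , λ { refl → y∉x (x∈⁅x⁆ x) }

  -∪⁅⁆ : ∀ {S : Subset m} {x} → x ∈ S → (S - x) ∪ ⁅ x ⁆ ≡ S
  -∪⁅⁆ {S} {x} x∈S = ⊆-antisym
    (λ y∈ → [ proj₁ ∘ ∈-⁻ {S = S} , (λ { refl → x∈S }) ]′ (∈∪⁅⁆⁻ {S = S - x} y∈))
    add
    where
    add : S ⊆ (S - x) ∪ ⁅ x ⁆
    add {y} y∈S with y Fin.≟ x
    ... | yes refl = ∈∪⁅⁆ʳ (S - x) x
    ... | no  y≢x  = ∈∪⁅⁆ˡ x (x∈p∧x≢y⇒x∈p-y y∈S y≢x)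

∣p-x∣ : ∀ {m} {S : Subset m} {x} → x ∈ S → suc ∣ S - x ∣ ≡ ∣ S ∣
∣p-x∣ {S = inside ∷ S} {Fin.zero} Vec.here = cong (suc ∘ ∣_∣) (p─⊥≡p S)
∣p-x∣ {S = inside ∷ S} {Fin.suc x} (Vec.there x∈) = cong suc (∣p-x∣ x∈)
∣p-x∣ {S = outside ∷ S} {Fin.suc x} (Vec.there x∈) = ∣p-x∣ x∈

-- Connected components and induced bonds.

module Connectivity {n : ℕ} (G : Graph n) where
  open Graph G
  open GraphNotions G

  private variable
    X Y F   : Subgraph
    e f     : Edge
    u v w t : Fin n

  Joins-sym : Joins e u v → Joins e v u
  Joins-sym (inj₁ p) = inj₂ p
  Joins-sym (inj₂ p) = inj₁ p

  Joins-lo-hi : Joins e (lo e) (hi e)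
  Joins-lo-hi = inj₁ (refl , refl)

  lo≢hi : ∀ e → lo e ≢ hi e
  lo≢hi e p = Fin.<-irrefl p (lo<hi e)

  Joins-injective : Joins e u v → Joins f u v → e ≡ f
  Joins-injective (inj₁ (refl , refl)) (inj₁ (p , q)) = simple (sym p) (sym q)
  Joins-injective (inj₂ (refl , refl)) (inj₂ (p , q)) = simple (sym p) (sym q)
  Joins-injective {e} {f = f} (inj₁ (refl , refl)) (inj₂ (p , q)) =
    ⊥-elim (Fin.<-asym (lo<hi e) (subst (Fin._< lo e) p (subst (lo f Fin.<_) q (lo<hi f))))
  Joins-injective {e} {f = f} (inj₂ (refl , refl)) (inj₁ (p , q)) =
    ⊥-elim (Fin.<-asym (lo<hi e) (subst (Fin._< lo e) p (subst (lo f Fin.<_) q (lo<hi f))))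

  Adjacent-sym : Adjacent X u v → Adjacent X v u
  Adjacent-sym (e , e∈ , j) = e , e∈ , Joins-sym {e} j

  Adjacent-mono : X ⊆ Y → Adjacent X u v → Adjacent Y u v
  Adjacent-mono X⊆Y (e , e∈ , j) = e , X⊆Y e∈ , j

  Connected-sym : Connected X u v → Connected X v u
  Connected-sym = Star.reverse Adjacent-sym

  Connected-mono : X ⊆ Y → Connected X u v → Connected Y u v
  Connected-mono X⊆Y = Star.map (Adjacent-mono X⊆Y)

  Joins⇒Connected : Connected X (lo e) (hi e) → Joins e u v → Connected X u v
  Joins⇒Connected c (inj₁ (refl , refl)) = c
  Joins⇒Connected c (inj₂ (refl , refl)) = Connected-sym c

  Joins⇒Connected⁻ : Joins e u v → Connected X u v → Connected X (lo e) (hi e)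
  Joins⇒Connected⁻ (inj₁ (refl , refl)) c = c
  Joins⇒Connected⁻ (inj₂ (refl , refl)) c = Connected-sym c

  ∈⇒Connected : e ∈ X → Connected X (lo e) (hi e)
  ∈⇒Connected {e} e∈ = (e , e∈ , Joins-lo-hi {e}) ◅ ε

  Connected-bind : (∀ e → e ∈ X → Connected Y (lo e) (hi e)) → Connected X u v → Connected Y u v
  Connected-bind h ε                 = ε
  Connected-bind h ((e , e∈ , j) ◅ c) = Joins⇒Connected (h e e∈) j ◅◅ Connected-bind h c

  Connected-⊥ : Connected ⊥ u v → u ≡ v
  Connected-⊥ ε                  = refl
  Connected-⊥ ((_ , e∈ , _) ◅ _) = ⊥-elim (∉⊥ e∈)

  -- A walk is shortened until it uses `e` at most once: if a step along `e` is followed by another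
  -- use of `e`, the part between the two uses is cut out, together with one or both of them.
  Connected-∪⁅⁆⁻ : Connected (X ∪ ⁅ e ⁆) u v →
                  Connected X u v ⊎ (Connected X u (lo e) × Connected X (hi e) v)
                                  ⊎ (Connected X u (hi e) × Connected X (lo e) v)
  Connected-∪⁅⁆⁻ ε = inj₁ ε
  Connected-∪⁅⁆⁻ {X} {e} ((f , f∈ , j) ◅ c) with ∈∪⁅⁆⁻ {S = X} f∈ | Connected-∪⁅⁆⁻ {X} {e} c
  ... | inj₁ f∈X | inj₁ p              = inj₁ ((f , f∈X , j) ◅ p)
  ... | inj₁ f∈X | inj₂ (inj₁ (p , q)) = inj₂ (inj₁ ((f , f∈X , j) ◅ p , q))
  ... | inj₁ f∈X | inj₂ (inj₂ (p , q)) = inj₂ (inj₂ ((f , f∈X , j) ◅ p , q))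
  Connected-∪⁅⁆⁻ ((f , f∈ , inj₁ (refl , refl)) ◅ c) | inj₂ refl | inj₁ p = inj₂ (inj₁ (ε , p))
  Connected-∪⁅⁆⁻ ((f , f∈ , inj₁ (refl , refl)) ◅ c) | inj₂ refl | inj₂ (inj₁ (p , q)) = inj₂ (inj₁ (ε , q))
  Connected-∪⁅⁆⁻ ((f , f∈ , inj₁ (refl , refl)) ◅ c) | inj₂ refl | inj₂ (inj₂ (p , q)) = inj₁ q
  Connected-∪⁅⁆⁻ ((f , f∈ , inj₂ (refl , refl)) ◅ c) | inj₂ refl | inj₁ p = inj₂ (inj₂ (ε , p))
  Connected-∪⁅⁆⁻ ((f , f∈ , inj₂ (refl , refl)) ◅ c) | inj₂ refl | inj₂ (inj₁ (p , q)) = inj₁ q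
  Connected-∪⁅⁆⁻ ((f , f∈ , inj₂ (refl , refl)) ◅ c) | inj₂ refl | inj₂ (inj₂ (p , q)) = inj₂ (inj₂ (ε , q))

  ∈-component⁺ : Connected X u v → v ∈ component X u
  ∈-component⁺ {X} {u} = ∈-tabulate⁺ (connected? X u)

  ∈-component⁻ : v ∈ component X u → Connected X u v
  ∈-component⁻ {X = X} {u = u} = ∈-tabulate⁻ (connected? X u)

  component-cong : (∀ {w} → Connected X u w → Connected Y v w) →
                   (∀ {w} → Connected Y v w → Connected X u w) →
                   component X u ≡ component Y v
  component-cong to from = ⊆-antisym (∈-component⁺ ∘ to ∘ ∈-component⁻)
                                     (∈-component⁺ ∘ from ∘ ∈-component⁻)

  Connected⇒component≡ : Connected X u v → component X u ≡ component X v
  Connected⇒component≡ c = component-cong (Connected-sym c ◅◅_) (c ◅◅_)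

  component≡⇒Connected : component X u ≡ component Y v → Connected X u w → Connected Y v w
  component≡⇒Connected eq c = ∈-component⁻ (subst (_ ∈_) eq (∈-component⁺ c))

  -- Equality of the partitions into components. `Noncrossing`, `cc` and `inducedBond` depend on
  -- nothing else, so an edge set and its induced bond are interchangeable for all three.
  _≈ᶜ_ : Rel Subgraph 0ℓ
  X ≈ᶜ Y = (∀ {u v} → Connected X u v → Connected Y u v) ×
           (∀ {u v} → Connected Y u v → Connected X u v)

  ≈ᶜ-sym : X ≈ᶜ Y → Y ≈ᶜ X
  ≈ᶜ-sym (p , q) = q , p

  ≈ᶜ-trans : X ≈ᶜ Y → Y ≈ᶜ F → X ≈ᶜ F
  ≈ᶜ-trans (p , q) (p′ , q′) = p′ ∘ p , q ∘ q′

  ∪⁅⁆-cong-≈ᶜ : X ≈ᶜ Y → (X ∪ ⁅ e ⁆) ≈ᶜ (Y ∪ ⁅ e ⁆)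
  ∪⁅⁆-cong-≈ᶜ X≈Y = half X≈Y , half (≈ᶜ-sym X≈Y)
    where
    half : X ≈ᶜ Y → Connected (X ∪ ⁅ e ⁆) u v → Connected (Y ∪ ⁅ e ⁆) u v
    half {X} {Y} {e = e} (to , _) = Connected-bind λ f f∈ →
      [ (λ f∈X → Connected-mono (∈∪⁅⁆ˡ e) (to (∈⇒Connected f∈X)))
      , (λ { refl → ∈⇒Connected (∈∪⁅⁆ʳ Y e) }) ]′ (∈∪⁅⁆⁻ {S = X} f∈)

  inducedBond-⊇ : F ⊆ inducedBond F
  inducedBond-⊇ {F} {e} e∈ = ∈-tabulate⁺ (λ e → connected? F (lo e) (hi e)) (∈⇒Connected e∈)

  ∈-inducedBond⁺ : Connected F (lo e) (hi e) → e ∈ inducedBond F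
  ∈-inducedBond⁺ {F} = ∈-tabulate⁺ (λ e → connected? F (lo e) (hi e))

  ∈-inducedBond⁻ : e ∈ inducedBond F → Connected F (lo e) (hi e)
  ∈-inducedBond⁻ {F = F} = ∈-tabulate⁻ (λ e → connected? F (lo e) (hi e))

  inducedBond-≈ᶜ : inducedBond F ≈ᶜ F
  inducedBond-≈ᶜ = Connected-bind (λ _ → ∈-inducedBond⁻) , Connected-mono inducedBond-⊇

  inducedBond-IsBond : IsBond (inducedBond F)
  inducedBond-IsBond v e p q = ∈-inducedBond⁺ (to (Connected-sym p ◅◅ q))
    where to = proj₁ inducedBond-≈ᶜ

  inducedBond-cong : X ≈ᶜ Y → inducedBond X ≡ inducedBond Y
  inducedBond-cong (to , from) = ⊆-antisym (∈-inducedBond⁺ ∘ to ∘ ∈-inducedBond⁻)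
                                           (∈-inducedBond⁺ ∘ from ∘ ∈-inducedBond⁻)

  module _ (bond : IsBond X) where

    bond-∈ : Connected X (lo e) (hi e) → e ∈ X
    bond-∈ {e} c = bond (lo e) e ε c

    -- Together with `inducedBond-⊇` and `inducedBond-IsBond` this makes `inducedBond` a closure
    -- operator whose closed sets are the bonds; inequalities `z ≤ y` with z an induced bond are
    -- obtained from it.
    inducedBond-least : F ⊆ X → inducedBond F ⊆ X
    inducedBond-least F⊆X e∈ = bond-∈ (Connected-mono F⊆X (∈-inducedBond⁻ e∈))

    inducedBond-of-bond : inducedBond X ≡ X
    inducedBond-of-bond = ⊆-antisym (inducedBond-least (λ e∈ → e∈)) inducedBond-⊇

  private
    _≟ˢ_ = Vec.≡-dec {n = n} Bool._≟_

    components : Subgraph → List (Subset n)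
    components X = deduplicate _≟ˢ_ (map (component X) (allFin n))

    components-unique : ∀ X → Unique (components X)
    components-unique X = deduplicate-! _≟ˢ_ (map (component X) (allFin n))

    ∈-components⁺ : ∀ X v → component X v ∈ˡ components X
    ∈-components⁺ X v = ∈-deduplicate⁺ _≟ˢ_ (∈-map⁺ (component X) (∈-allFin v))

    ∈-components⁻ : ∀ {T} → T ∈ˡ components X → ∃[ v ] T ≡ component X v
    ∈-components⁻ {X} T∈ with ∈-map⁻ (component X) (∈-deduplicate⁻ _≟ˢ_ (map (component X) (allFin n)) T∈)
    ... | v , _ , eq = v , eq

  cc≤n : ∀ X → cc X ℕ.≤ n
  cc≤n X = ℕ.≤-trans (List.length-deduplicate _≟ˢ_ (map (component X) (allFin n)))
    (ℕ.≤-reflexive (trans (List.length-map (component X) (allFin n)) (List.length-tabulate (λ i → i))))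

  cc-cong : X ≈ᶜ Y → cc X ≡ cc Y
  cc-cong X≈Y = cong (length ∘ deduplicate _≟ˢ_)
    (List.map-cong (λ v → component-cong (proj₁ X≈Y) (proj₂ X≈Y)) (allFin n))

  cc-⊥ : cc ⊥ ≡ n
  cc-⊥ = trans
    (unique-set⇒length≡ (components-unique ⊥)
       (Unique.map⁺ (λ {u} {v} eq → sym (Connected-⊥ {v} {u} (component≡⇒Connected {X = ⊥} {u} eq ε))) (Unique.allFin⁺ n))
       (∈-deduplicate⁻ _≟ˢ_ (map (component ⊥) (allFin n))) (∈-deduplicate⁺ _≟ˢ_))
    (trans (List.length-map (component ⊥) (allFin n)) (List.length-tabulate (λ i → i)))

  -- The components of X are that of hi e and, for every component T of
  -- X ∪ ⁅ e ⁆, the set "shrink T".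
  cc-∪⁅⁆ : ¬ Connected X (lo e) (hi e) → cc X ≡ suc (cc (X ∪ ⁅ e ⁆))
  cc-∪⁅⁆ {X} {e} lo≁hi = trans
    (unique-set⇒length≡ (components-unique X)
       (All.tabulate (λ T∈ eq → hi∉ T∈ eq) ∷ unique-map-on shrink shrink-inj (components-unique X⁺))
       to from)
    (cong suc (List.length-map shrink (components X⁺)))
    where
    X⁺ = X ∪ ⁅ e ⁆

    X⇒X⁺ : Connected X u v → Connected X⁺ u v
    X⇒X⁺ = Connected-mono (∈∪⁅⁆ˡ e)

    hi~lo : Connected X⁺ (hi e) (lo e)
    hi~lo = Connected-sym (∈⇒Connected (∈∪⁅⁆ʳ X e))

    shrink : Subset n → Subset n
    shrink T with lo e ∈? T
    ... | yes _ = component X (lo e)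
    ... | no  _ = T

    untouched : ¬ Connected X⁺ v (lo e) → component X⁺ v ≡ component X v
    untouched {v} v≁lo = component-cong to X⇒X⁺
      where
      to : Connected X⁺ v w → Connected X v w
      to c with Connected-∪⁅⁆⁻ {X} {e} c
      ... | inj₁ p              = p
      ... | inj₂ (inj₁ (p , _)) = ⊥-elim (v≁lo (X⇒X⁺ p))
      ... | inj₂ (inj₂ (p , _)) = ⊥-elim (v≁lo (X⇒X⁺ p ◅◅ hi~lo))

    shrink-touched : Connected X⁺ v (lo e) → shrink (component X⁺ v) ≡ component X (lo e)
    shrink-touched {v} c with lo e ∈? component X⁺ v
    ... | yes _ = refl
    ... | no ¬p = ⊥-elim (¬p (∈-component⁺ c))

    shrink-untouched : ¬ Connected X⁺ v (lo e) → shrink (component X⁺ v) ≡ component X v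
    shrink-untouched {v} ¬c with lo e ∈? component X⁺ v
    ... | yes p = ⊥-elim (¬c (∈-component⁻ p))
    ... | no _  = untouched ¬c

    shrink-inj : ∀ {T T′} → T ∈ˡ components X⁺ → T′ ∈ˡ components X⁺ → shrink T ≡ shrink T′ → T ≡ T′
    shrink-inj T∈ T′∈ eq with ∈-components⁻ T∈ | ∈-components⁻ T′∈
    ... | u , refl | v , refl with connected? X⁺ u (lo e) | connected? X⁺ v (lo e)
    ... | yes p | yes q = Connected⇒component≡ (p ◅◅ Connected-sym q)
    ... | yes p | no ¬q = ⊥-elim (¬q (X⇒X⁺
      (component≡⇒Connected (trans (sym (shrink-touched p)) (trans eq (shrink-untouched ¬q))) ε)))
    ... | no ¬p | yes q = ⊥-elim (¬p (X⇒X⁺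
      (component≡⇒Connected (trans (sym (shrink-touched q)) (trans (sym eq) (shrink-untouched ¬p))) ε)))
    ... | no ¬p | no ¬q = trans (untouched ¬p) (trans (trans (sym (shrink-untouched ¬p))
                            (trans eq (shrink-untouched ¬q))) (sym (untouched ¬q)))

    hi∉ : ∀ {T} → T ∈ˡ map shrink (components X⁺) → component X (hi e) ≢ T
    hi∉ T∈ eq with ∈-map⁻ shrink T∈
    ... | U , U∈ , refl with ∈-components⁻ U∈
    ... | v , refl with connected? X⁺ v (lo e)
    ... | yes p = lo≁hi (component≡⇒Connected (trans eq (shrink-touched p)) ε)
    ... | no ¬p = ¬p (X⇒X⁺ (component≡⇒Connected (trans eq (shrink-untouched ¬p)) ε) ◅◅ hi~lo)

    to : ∀ {T} → T ∈ˡ components X → T ∈ˡ component X (hi e) ∷ map shrink (components X⁺)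
    to T∈ with ∈-components⁻ T∈
    ... | v , refl with connected? X v (hi e) | connected? X v (lo e)
    ... | yes p | _     = here (Connected⇒component≡ p)
    ... | no ¬p | yes q = there (subst (_∈ˡ map shrink (components X⁺))
                                  (trans (shrink-touched (X⇒X⁺ q)) (sym (Connected⇒component≡ q)))
                                  (∈-map⁺ shrink (∈-components⁺ X⁺ v)))
    ... | no ¬p | no ¬q = there (subst (_∈ˡ map shrink (components X⁺)) (shrink-untouched v≁lo)
                                  (∈-map⁺ shrink (∈-components⁺ X⁺ v)))
      where
      v≁lo : ¬ Connected X⁺ v (lo e)
      v≁lo c with Connected-∪⁅⁆⁻ {X} {e} c
      ... | inj₁ q              = ¬q q
      ... | inj₂ (inj₁ (q , _)) = ¬q q
      ... | inj₂ (inj₂ (p , _)) = ¬p p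

    from : ∀ {T} → T ∈ˡ component X (hi e) ∷ map shrink (components X⁺) → T ∈ˡ components X
    from (here refl) = ∈-components⁺ X (hi e)
    from (there T∈) with ∈-map⁻ shrink T∈
    ... | U , U∈ , refl with ∈-components⁻ U∈
    ... | v , refl with connected? X⁺ v (lo e)
    ... | yes p = subst (_∈ˡ components X) (sym (shrink-touched p)) (∈-components⁺ X (lo e))
    ... | no ¬p = subst (_∈ˡ components X) (sym (shrink-untouched ¬p)) (∈-components⁺ X v)

-- Noncrossing edges versus noncrossing components.

star-exit : ∀ {A : Set} {R : Rel A 0ℓ} {P : Pred A 0ℓ} → Decidable P → ∀ {s t} →
            Star R s t → P s → ¬ P t →
            ∃[ u ] ∃[ w ] (Star R s u × R u w × P u × ¬ P w)
star-exit P? ε Ps ¬Pt = ⊥-elim (¬Pt Ps)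
star-exit P? (_◅_ {s} {w} r rs) Ps ¬Pt with P? w
... | no ¬Pw = s , w , ε , r , Ps , ¬Pw
... | yes Pw with star-exit P? rs Pw ¬Pt
...   | u , w , rs′ , r′ , Pu , ¬Pw = u , w , r ◅ rs′ , r′ , Pu , ¬Pw

module NoncrossingSets {n : ℕ} (G : Graph n) where
  open Graph G
  open GraphNotions G
  open Connectivity G

  private variable
    X Y F S : Subgraph
    e f     : Edge
    u v w t : Fin n

  NoncrossingEdges : Subgraph → Set
  NoncrossingEdges S = ∀ e f → e ∈ S → f ∈ S → ¬ Crossing e f

  Between : Edge → Fin n → Set
  Between e v = lo e Fin.< v × v Fin.< hi e

  -- An edge from a vertex strictly under the arc `e` to a vertex strictly outside it would cross
  -- `e`.
  between-step : NoncrossingEdges S → e ∈ S → Adjacent S u w → Between e u →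
                 w ≢ lo e → w ≢ hi e → Between e w
  between-step {e = e} {u} {w} nc e∈ (f , f∈ , j) (l , r) w≢lo w≢hi
    with Fin.<-cmp (lo e) w | Fin.<-cmp w (hi e)
  ... | tri< p _ _ | tri< q _ _ = p , q
  ... | tri≈ _ p _ | _          = ⊥-elim (w≢lo (sym p))
  ... | tri< _ _ _ | tri≈ _ q _ = ⊥-elim (w≢hi q)
  ... | tri> _ _ p | _          = ⊥-elim (nc e f e∈ f∈ (below j))
    where
    below : Joins f u w → Crossing e f
    below (inj₁ (refl , refl)) = ⊥-elim (Fin.<-asym (lo<hi f) (Fin.<-trans p l))
    below (inj₂ (refl , refl)) = inj₂ (p , l , r)
  ... | tri< _ _ _ | tri> _ _ q = ⊥-elim (nc e f e∈ f∈ (above j))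
    where
    above : Joins f u w → Crossing e f
    above (inj₁ (refl , refl)) = inj₁ (l , r , q)
    above (inj₂ (refl , refl)) = ⊥-elim (Fin.<-asym (lo<hi f) (Fin.<-trans r q))

  -- A walk can leave the space under the arc `e` only through an end of `e`, and then it would lie
  -- in the component of `e`. So an arc of another component cannot have exactly one of two
  -- connected vertices under it.
  between-connected : NoncrossingEdges S → e ∈ S → ¬ Connected S (lo e) u →
                      Connected S u v → Between e u → Between e v
  between-connected nc e∈ lo≁u ε b = b
  between-connected {S} {e} nc e∈ lo≁u (_◅_ {j = w} a c) b =
    between-connected nc e∈ lo≁w c (between-step nc e∈ a b
      (λ { refl → lo≁w ε }) (λ { refl → lo≁w (∈⇒Connected e∈) }))
    where
    lo≁w : ¬ Connected S (lo e) w
    lo≁w d = lo≁u (d ◅◅ (Adjacent-sym a ◅ ε))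

  -- A walk from b to d leaves the interval ]a , c[ along an edge that has
  -- exactly one of a and c strictly between its ends.
  NoncrossingEdges⇒Noncrossing : NoncrossingEdges S → Noncrossing S
  NoncrossingEdges⇒Noncrossing {S} nc a b c d (a<b , b<c , c<d , a~c , b~d , a≁b)
    with star-exit {P = λ v → a Fin.< v × v Fin.< c}
           (λ v → (a Fin.<? v) ×-dec (v Fin.<? c)) b~d (a<b , b<c)
           (λ (_ , d<c) → Fin.<-asym c<d d<c)
  ... | u , w , b~u , (g , g∈ , j) , (a<u , u<c) , w∉ = exit j (Fin.<-cmp w c) (Fin.<-cmp a w)
    where
    a≁u : ¬ Connected S a u
    a≁u p = a≁b (p ◅◅ Connected-sym b~u)

    u~w : Connected S u w
    u~w = (g , g∈ , j) ◅ ε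

    exit : Joins g u w → _ → _ → _
    exit _ _ (tri≈ _ refl _) = a≁u (Connected-sym u~w)
    exit _ (tri≈ _ refl _) _ = a≁u (a~c ◅◅ Connected-sym u~w)
    exit _ (tri< w<c _ _) (tri< a<w _ _) = w∉ (a<w , w<c)
    exit (inj₁ (refl , refl)) (tri> _ _ c<w) _ = Fin.<-asym a<u (proj₁
      (between-connected nc g∈ (λ p → a≁u (a~c ◅◅ Connected-sym p)) (Connected-sym a~c) (u<c , c<w)))
    exit (inj₂ (refl , refl)) (tri> _ _ c<w) _ = Fin.<-asym (lo<hi g) (Fin.<-trans u<c c<w)
    exit (inj₂ (refl , refl)) _ (tri> _ _ w<a) = Fin.<-asym u<c (proj₂
      (between-connected nc g∈ (λ p → a≁u (Connected-sym p ◅◅ Connected-sym u~w)) a~c (w<a , a<u)))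
    exit (inj₁ (refl , refl)) _ (tri> _ _ w<a) = Fin.<-asym (lo<hi g) (Fin.<-trans w<a a<u)

  Noncrossing-cong : X ≈ᶜ Y → Noncrossing X → Noncrossing Y
  Noncrossing-cong (to , from) nc a b c d (p , q , r , a~c , b~d , a≁b) =
    nc a b c d (p , q , r , from a~c , from b~d , a≁b ∘ to)

-- Paths and cycles.

module Cycles {n : ℕ} (G : Graph n) where
  open Graph G
  open GraphNotions G
  open Connectivity G

  private variable
    X Y F S C : Subgraph
    e f       : Edge
    u v w t   : Fin n
    vs        : List (Fin n)

  -- The list omits the first vertex.
  data Walk (F : Subgraph) : Fin n → List (Fin n) → Fin n → Set where
    []  : Walk F v [] v
    _∷_ : Adjacent F u w → Walk F w vs v → Walk F u (w ∷ vs) v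

  private
    _∈ˡ?_ = ∈ˡ-dec (Fin._≟_ {n})

    suffix : Walk F u vs v → Unique (u ∷ vs) → t ∈ˡ u ∷ vs →
             ∃[ ws ] (Walk F t ws v × Unique (t ∷ ws))
    suffix p       uq       (here refl) = _ , p , uq
    suffix (a ∷ p) (_ ∷ uq) (there t∈)  = suffix p uq t∈

  simpleWalk : Connected F u v → ∃[ vs ] (Walk F u vs v × Unique (u ∷ vs))
  simpleWalk ε = [] , [] , [] ∷ []
  simpleWalk {F} {u} (a ◅ c) with simpleWalk c
  ... | vs , p , uq with u ∈ˡ? (_ ∷ vs)
  ...   | yes u∈ = suffix p uq u∈
  ...   | no  u∉ = _ , a ∷ p , ¬Any⇒All¬ _ u∉ ∷ uq

  closeWalk : Walk F u vs v → Adjacent F v t →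
              All (uncurry (Adjacent F)) (zip (u ∷ vs) (vs ++ t ∷ []))
  closeWalk []      a = a ∷ []
  closeWalk (b ∷ p) a = b ∷ closeWalk p a

  -- A simple walk in `F` between the ends of `f` is closed up by `f`. The cycle is collected as the
  -- set of all edges joining consecutive vertices; as the graph is simple, these are just the edges
  -- walked, which gives the final inclusion.
  Connected⇒cycle : f ∉ F → Connected F (lo f) (hi f) →
                    ∃[ C ] (IsCycle C × f ∈ C × C ⊆ F ∪ ⁅ f ⁆)
  Connected⇒cycle {f} {F} f∉F c with simpleWalk c
  ... | vs , p , uq = circuit , (lo f , vs , uq , long p , circuit-adjacent , λ _ → ∈-tabulate⁻ onCycle?) ,
                      ∈-tabulate⁺ onCycle? (closes p) , circuit⊆
    where
    onCycle? : Decidable λ e → Any (uncurry (Joins e)) (steps (lo f) vs)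
    onCycle? e = Any.any? (λ (a , b) → joins? e a b) (steps (lo f) vs)

    circuit : Subgraph
    circuit = Vec.tabulate (does ∘ onCycle?)

    -- A walk of a single step would be `f` itself, which is not in `F`.
    long : ∀ {vs} → Walk F (lo f) vs (hi f) → 2 ℕ.≤ length vs
    long p = len p refl refl
      where
      len : ∀ {u v vs} → Walk F u vs v → u ≡ lo f → v ≡ hi f → 2 ℕ.≤ length vs
      len []                      refl eq   = ⊥-elim (lo≢hi f eq)
      len ((e , e∈ , j) ∷ [])    refl refl =
        ⊥-elim (f∉F (subst (_∈ F) (Joins-injective j (Joins-lo-hi {f})) e∈))
      len (_ ∷ (_ ∷ _))           _    _    = s≤s (s≤s z≤n)

    F⁺-adjacent : All (uncurry (Adjacent (F ∪ ⁅ f ⁆))) (steps (lo f) vs)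
    F⁺-adjacent = closeWalk (mono p) (f , ∈∪⁅⁆ʳ F f , Joins-sym {f} (Joins-lo-hi {f}))
      where
      mono : ∀ {u vs v} → Walk F u vs v → Walk (F ∪ ⁅ f ⁆) u vs v
      mono []      = []
      mono (a ∷ p) = Adjacent-mono (∈∪⁅⁆ˡ f) a ∷ mono p

    circuit-adjacent : All (uncurry (Adjacent circuit)) (steps (lo f) vs)
    circuit-adjacent = All.tabulate λ ab∈ → let e , _ , j = All.lookup F⁺-adjacent ab∈ in
      e , ∈-tabulate⁺ onCycle? (lose ab∈ j) , j

    closes : ∀ {u vs} → Walk F u vs (hi f) → Any (uncurry (Joins f)) (zip (u ∷ vs) (vs ++ lo f ∷ []))
    closes []      = here (Joins-sym {f} (Joins-lo-hi {f}))
    closes (_ ∷ p) = there (closes p)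

    circuit⊆ : circuit ⊆ F ∪ ⁅ f ⁆
    circuit⊆ e∈ with find (∈-tabulate⁻ onCycle? e∈)
    ... | _ , ab∈ , j with All.lookup F⁺-adjacent ab∈
    ...   | e′ , e′∈ , j′ = subst (_∈ F ∪ ⁅ f ⁆) (Joins-injective j′ j) e′∈

  private
    openWalk : All (uncurry (Adjacent C)) (zip (u ∷ vs) (vs ++ t ∷ [])) →
               ∃[ v ] (Walk C u vs v × Adjacent C v t ×
                 (Any (uncurry (Joins e)) (zip (u ∷ vs) (vs ++ t ∷ [])) →
                  Any (uncurry (Joins e)) (zip (u ∷ vs) vs) ⊎ Joins e v t))
    openWalk {vs = []}     (a ∷ []) = _ , [] , a , λ { (here j) → inj₂ j }
    openWalk {vs = w ∷ vs} (a ∷ as) with openWalk {vs = vs} as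
    ... | v , p , b , split = v , a ∷ p , b , λ
      { (here j)  → inj₁ (here j)
      ; (there x) → [ inj₁ ∘ there , inj₂ ]′ (split x) }

    Joins-start : Joins e u v → t ≡ lo e ⊎ t ≡ hi e → t ≡ u ⊎ t ≡ v
    Joins-start (inj₁ (refl , refl)) p = p
    Joins-start (inj₂ (refl , refl)) (inj₁ p) = inj₂ p
    Joins-start (inj₂ (refl , refl)) (inj₂ p) = inj₁ p

    Joins-ends : Joins e u v → u ≡ lo e ⊎ u ≡ hi e
    Joins-ends (inj₁ (refl , refl)) = inj₁ refl
    Joins-ends (inj₂ (refl , refl)) = inj₂ refl

    -- An edge differs from `e` as soon as one end `t` of `e` is not among its ends;
    -- vertex-distinctness of walks thus turns into avoidance of `e`.
    avoid-edge : ∀ {g} → g ∈ C → Joins g u v → t ≡ lo e ⊎ t ≡ hi e → t ≢ u → t ≢ v →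
                 Adjacent (C - e) u v
    avoid-edge g∈ j t-end t≢u t≢v =
      _ , x∈p∧x≢y⇒x∈p-y g∈ (λ { refl → [ t≢u , t≢v ]′ (Joins-start j t-end) }) , j

    avoid-walk : Walk C u vs v → t ≡ lo e ⊎ t ≡ hi e → t ∉ˡ u ∷ vs → Connected (C - e) u v
    avoid-walk []                 _     _  = ε
    avoid-walk ((g , g∈ , j) ∷ p) t-end t∉ =
      avoid-edge g∈ j t-end (t∉ ∘ here) (t∉ ∘ there ∘ here) ◅ avoid-walk p t-end (t∉ ∘ there)

    -- The simple walk is cut at its step along `e`, from `a` to `b`. The vertices being distinct,
    -- `b` does not occur before that step and `a` not after it, so neither piece uses `e`. The
    -- clause `b ∈ˡ vs` carries this through the induction.
    avoid-step : Walk C u vs v → Unique (u ∷ vs) → Any (uncurry (Joins e)) (zip (u ∷ vs) vs) →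
                 ∃[ a ] ∃[ b ] (Joins e a b × b ∈ˡ vs ×
                                Connected (C - e) u a × Connected (C - e) b v)
    avoid-step {u = u} {e = e} (_∷_ {w = w} _ p) (u∉ ∷ _) (here j) =
      u , w , j , here refl , ε , avoid-walk p (Joins-ends j) (All¬⇒¬Any u∉)
    avoid-step {u = u} ((g , g∈ , h) ∷ p) (u∉ ∷ uq) (there x) with avoid-step p uq x
    ... | a , b , j , b∈ , c , d =
      a , b , j , there b∈ ,
      avoid-edge g∈ h (Joins-ends {v = a} (Joins-sym j))
        (λ { refl → All¬⇒¬Any u∉ (there b∈) })
        (λ { refl → b∉ uq b∈ }) ◅ c , d
      where
      b∉ : ∀ {w ws} → Unique (w ∷ ws) → ¬ w ∈ˡ ws
      b∉ (w∉ ∷ _) = All¬⇒¬Any w∉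

  -- The cycle is opened at the step from its last vertex `w` back to `v`. Either `e` is this
  -- closing step, and the open walk avoids it, or `e` is a step of the open walk, and the two
  -- remaining pieces are linked by the closing step.
  cycle-minus-edge-connected : IsCycle C → e ∈ C → Connected (C - e) (lo e) (hi e)
  cycle-minus-edge-connected {C} {e} (v , vs , uq , long , adj , covers) e∈
    with openWalk {vs = vs} adj
  ... | w , p , (h , h∈ , j) , split with joins? e w v
  ...   | yes e-closes = Joins⇒Connected⁻ (Joins-sym e-closes) (direct p uq long)
    where
    last∈ : ∀ {u vs} → Walk C u vs w → w ∈ˡ u ∷ vs
    last∈ []      = here refl
    last∈ (_ ∷ p) = there (last∈ p)

    direct : ∀ {vs} → Walk C v vs w → Unique (v ∷ vs) → 2 ℕ.≤ length vs → Connected (C - e) v w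
    -- A one-step walk could be `e` itself; a cycle has at least three vertices, so the first step
    -- misses `w` and the later ones miss `v`.
    direct (_ ∷ []) _ (s≤s ())
    direct ((g , g∈ , i) ∷ p@(_ ∷ q)) (v∉ ∷ (x∉ ∷ _)) _ =
      avoid-edge g∈ i (Joins-ends e-closes)
        (λ { refl → All¬⇒¬Any v∉ (last∈ p) }) (λ { refl → All¬⇒¬Any x∉ (last∈ q) })
      ◅ avoid-walk p (Joins-ends {v = w} (Joins-sym e-closes)) (All¬⇒¬Any v∉)
  ...   | no ¬e-closes with split (covers e e∈)
  ...     | inj₂ e-closes = ⊥-elim (¬e-closes e-closes)
  ...     | inj₁ x with avoid-step p uq x
  ...       | a , b , i , _ , v~a , b~w =
    Joins⇒Connected⁻ i (Connected-sym (b~w ◅◅ (w-v ◅ v~a)))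
    where
    w-v : Adjacent (C - e) w v
    w-v = h , x∈p∧x≢y⇒x∈p-y h∈ (λ { refl → ¬e-closes j }) , j

  cycle-nonempty : IsCycle C → ∃[ e ] e ∈ C
  cycle-nonempty (v , [] , _ , () , _)
  cycle-nonempty (v , _ ∷ _ , _ , _ , (e , e∈ , _) ∷ _ , _) = e , e∈

-- NBC sets: independence of the ambient bond, forests, least edges.

module NBCSets {n : ℕ} (G : Graph n) (_⊴_ : Rel (GraphNotions.Edge G) 0ℓ)
               (⊴-isTotalOrder : IsTotalOrder _≡_ _⊴_) where
  open Graph G
  open OrderedGraph G _⊴_ ⊴-isTotalOrder
  open Connectivity G
  open NoncrossingSets G
  open Cycles G
  module ⊴ = IsTotalOrder ⊴-isTotalOrder

  private variable
    X Z S S′ C : Subgraph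
    e f        : Edge

  ◁-isStrictTotalOrder : IsStrictTotalOrder _≡_ _◁_
  ◁-isStrictTotalOrder = ToStrict.<-isStrictTotalOrder₁ _≡_ _⊴_ Fin._≟_ ⊴-isTotalOrder

  module ◁ = IsStrictTotalOrder ◁-isStrictTotalOrder

  InducedNoncrossing : Set
  InducedNoncrossing = ∀ H H′ e → H < H′ → Least (E H′ ─ E H) e →
                       Noncrossing (inducedBond (E H ∪ ⁅ e ⁆))

  Least-unique : Least S e → Least S f → e ≡ f
  Least-unique {e = e} {f} (e∈ , e⊴) (f∈ , f⊴) = ⊴.antisym (e⊴ f f∈) (f⊴ e e∈)

  minEdge-Least : ∀ S .(ne : Nonempty S) → Least S (minEdge S ne)
  minEdge-Least S ne = proj₂ (least S (recompute (nonempty? S) ne))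

  IsNBC-⊆ : IsNBC X S → S′ ⊆ S → IsNBC X S′
  IsNBC-⊆ (S⊆X , ∄B) S′⊆S = S⊆X ∘ S′⊆S , λ (B , bc , B⊆S′) → ∄B (B , bc , S′⊆S ∘ B⊆S′)

  IsNBC-restrict : X ⊆ Z → S ⊆ X → IsNBC Z S → IsNBC X S
  IsNBC-restrict X⊆Z S⊆X (_ , ∄B) =
    S⊆X , λ (B , (C , cyc , C⊆X , rest) , B⊆S) → ∄B (B , (C , cyc , X⊆Z ∘ C⊆X , rest) , B⊆S)

  -- The rest of the cycle still connects the ends of `e`, and a bond contains every edge whose ends
  -- it connects.
  broken-circuit-closed : IsBond X → IsCycle C → e ∈ C → C - e ⊆ X → C ⊆ X
  broken-circuit-closed {X} {C} {e} bond cyc e∈ B⊆X {f} f∈ with f Fin.≟ e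
  ... | yes refl = bond-∈ bond (Connected-mono B⊆X (cycle-minus-edge-connected cyc e∈))
  ... | no  f≢e  = B⊆X (x∈p∧x≢y⇒x∈p-y f∈ f≢e)

  -- A cycle of `Z` whose broken circuit lies in S ⊆ X is already a cycle of `X`, because `X` is a
  -- bond. This is what makes counts in different bonds comparable.
  IsNBC-extend : IsBond X → X ⊆ Z → IsNBC X S → IsNBC Z S
  IsNBC-extend bond X⊆Z (S⊆X , ∄B) = X⊆Z ∘ S⊆X , λ
    { (B , (C , cyc , _ , e , l@(e∈ , _) , refl) , B⊆S) →
      ∄B (B , (C , cyc , broken-circuit-closed bond cyc e∈ (S⊆X ∘ B⊆S) , e , l , refl) , B⊆S) }

  IsNBC⇒acyclic : IsNBC X S → IsCycle C → ¬ C ⊆ S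
  IsNBC⇒acyclic {C = C} (S⊆X , ∄B) cyc C⊆S =
    let e , l = least C (cycle-nonempty cyc) in
    ∄B (C - e , (C , cyc , S⊆X ∘ C⊆S , e , l , refl) , C⊆S ∘ p─q⊆p C ⁅ e ⁆)

  IsNBC⇒¬Connected : IsNBC X S → e ∈ S → ¬ Connected (S - e) (lo e) (hi e)
  IsNBC⇒¬Connected {S = S} {e} nbc e∈ c =
    let C , cyc , _ , C⊆ = Connected⇒cycle (λ e∈S-e → proj₂ (∈-⁻ {S = S} e∈S-e) refl) c in
    IsNBC⇒acyclic nbc cyc (subst (C ⊆_) (-∪⁅⁆ e∈) C⊆)

  IsNBC⇒cc : IsNBC X S → e ∈ S → cc (S - e) ≡ suc (cc S)
  IsNBC⇒cc nbc e∈ = trans (cc-∪⁅⁆ (IsNBC⇒¬Connected nbc e∈)) (cong (suc ∘ cc) (-∪⁅⁆ e∈))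

  -- The forest formula, by deleting edges down to the empty set, which has `n` components. The
  -- additive form is kept beside `IsNBC⇒∣∣` because it allows cancellation, which truncated
  -- subtraction does not.
  IsNBC⇒∣∣+cc : IsNBC X S → ∣ S ∣ ℕ.+ cc S ≡ n
  IsNBC⇒∣∣+cc {X} {S} nbc = go ∣ S ∣ refl nbc
    where
    open ≡-Reasoning
    go : ∀ {S} k → ∣ S ∣ ≡ k → IsNBC X S → k ℕ.+ cc S ≡ n
    go {S} k eq nbc with nonempty? S
    go {S} k eq nbc | no ¬ne with Empty-unique ¬ne
    ... | refl = trans (cong (ℕ._+ cc ⊥) (trans (sym eq) (∣⊥∣≡0 size))) cc-⊥
    go {S} zero eq nbc | yes (e , e∈) with trans (∣p-x∣ e∈) eq
    ... | ()
    go {S} (suc k) eq nbc | yes (e , e∈) = begin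
      suc k ℕ.+ cc S       ≡⟨ ℕ.+-suc k (cc S) ⟨
      k ℕ.+ suc (cc S)     ≡⟨ cong (k ℕ.+_) (IsNBC⇒cc nbc e∈) ⟨
      k ℕ.+ cc (S - e)     ≡⟨ go k (ℕ.suc-injective (trans (∣p-x∣ e∈) eq)) (IsNBC-⊆ nbc (p─q⊆p S ⁅ e ⁆)) ⟩
      n                    ∎

  IsNBC⇒∣∣ : IsNBC X S → ∣ S ∣ ≡ n ∸ cc S
  IsNBC⇒∣∣ {S = S} nbc = trans (sym (ℕ.m+n∸n≡m ∣ S ∣ (cc S))) (cong (_∸ cc S) (IsNBC⇒∣∣+cc nbc))

  component≡⇒≈ᶜ : (∀ v → component S v ≡ component X v) → S ≈ᶜ X
  component≡⇒≈ᶜ eq = component≡⇒Connected (eq _) , component≡⇒Connected (sym (eq _))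

  ≈ᶜ⇒component≡ : S ≈ᶜ X → ∀ v → component S v ≡ component X v
  ≈ᶜ⇒component≡ (to , from) v = component-cong to from

  -- Otherwise f would be the least edge of a cycle in S ∪ ⁅ f ⁆.
  spanning-NBC-dominates : IsNBC X S → S ≈ᶜ X → f ∈ X → ∃[ e ] (e ∈ S × e ⊴ f)
  spanning-NBC-dominates {X} {S} {f} (S⊆X , ∄B) (_ , from) f∈X with f ∈? S
  ... | yes f∈S = f , f∈S , ⊴.refl
  ... | no  f∉S with Connected⇒cycle f∉S (from (∈⇒Connected f∈X))
  ...   | C , cyc , f∈C , C⊆ with least C (f , f∈C)
  ...     | e , l@(e∈C , e⊴) with ∈∪⁅⁆⁻ {S = S} (C⊆ e∈C)
  ...       | inj₁ e∈S  = e , e∈S , e⊴ f f∈C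
  ...       | inj₂ refl = ⊥-elim (∄B (C - f , (C , cyc , C⊆X , f , l , refl) , B⊆S))
    where
    C⊆X : C ⊆ X
    C⊆X g∈ = [ S⊆X , (λ { refl → f∈X }) ]′ (∈∪⁅⁆⁻ {S = S} (C⊆ g∈))
    B⊆S : C - f ⊆ S
    B⊆S g∈ = let g∈C , g≢f = ∈-⁻ {S = C} g∈ in
      [ (λ g∈S → g∈S) , (λ g≡f → ⊥-elim (g≢f g≡f)) ]′ (∈∪⁅⁆⁻ {S = S} (C⊆ g∈C))

  Least-spanning-NBC : IsNBC X S → S ≈ᶜ X → Least S e → Least X e
  Least-spanning-NBC nbc S≈X (e∈ , e⊴) = proj₁ nbc e∈ , λ f f∈X →
    let g , g∈S , g⊴f = spanning-NBC-dominates nbc S≈X f∈X in ⊴.trans (e⊴ g g∈S) g⊴f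

-- Covers in the poset of noncrossing bonds.

module _ (P : FinitePoset) where
  open FinitePoset P

  -- Chains store their cover proofs irrelevantly; decidability makes the proofs recoverable and
  -- also drives the enumeration of chains.
  ⋖-dec : Decidable₂ _⋖_
  ⋖-dec x y = (x <? y) ×-dec
    map′ (λ all z → All.lookup all (elements-complete z)) (λ h → All.tabulate λ {z} _ → h z)
         (All.all? (λ z → ¬? ((x <? z) ×-dec (z <? y))) elements)

  ⋖-recompute : ∀ {x y} → .(x ⋖ y) → x ⋖ y
  ⋖-recompute {x} {y} = recompute (⋖-dec x y)

module NoncrossingBonds
  {n : ℕ} (G : Graph n) (_⊴_ : Rel (GraphNotions.Edge G) 0ℓ) (⊴-isTotalOrder : IsTotalOrder _≡_ _⊴_)
  (induced-noncrossing : NBCSets.InducedNoncrossing G _⊴_ ⊴-isTotalOrder)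
  where
  open OrderedGraph G _⊴_ ⊴-isTotalOrder
  open Graph G
  open Connectivity G
  open NoncrossingSets G
  open NBCSets G _⊴_ ⊴-isTotalOrder
  open FinitePoset NC using (_⋖_; _≟_)
  module ≤ = IsDecPartialOrder (FinitePoset.isDecPartialOrder NC)

  private variable
    x y z : NoncrossingBond
    S     : Subgraph
    e f   : Edge
    u v   : Fin n

  isBond : ∀ x → IsBond (E x)
  isBond x@(_ Refinement., [ p ]) = proj₁ (recompute (isNoncrossingBond? (E x)) p)

  noncrossing : ∀ x → Noncrossing (E x)
  noncrossing x@(_ Refinement., [ p ]) = proj₂ (recompute (isNoncrossingBond? (E x)) p)

  inducedNC : ∀ S → Noncrossing S → NoncrossingBond
  inducedNC S nc = inducedBond S Refinement., [ inducedBond-IsBond , Noncrossing-cong (≈ᶜ-sym inducedBond-≈ᶜ) nc ]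

  Connected-⁅⁆ : Connected ⁅ f ⁆ u v → u ≢ lo f → u ≢ hi f → u ≡ v
  Connected-⁅⁆ ε _ _ = refl
  Connected-⁅⁆ {f} ((g , g∈ , j) ◅ _) u≢lo u≢hi with x∈⁅y⁆⇒x≡y f g∈
  Connected-⁅⁆ ((g , _ , inj₁ (refl , _)) ◅ _) u≢lo u≢hi | refl = ⊥-elim (u≢lo refl)
  Connected-⁅⁆ ((g , _ , inj₂ (_ , refl)) ◅ _) u≢lo u≢hi | refl = ⊥-elim (u≢hi refl)

  ¬Crossing-refl : ¬ Crossing e e
  ¬Crossing-refl (inj₁ (p , _)) = Fin.<-irrefl refl p
  ¬Crossing-refl (inj₂ (p , _)) = Fin.<-irrefl refl p

  Crossing-sym : Crossing e f → Crossing f e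
  Crossing-sym (inj₁ p) = inj₂ p
  Crossing-sym (inj₂ p) = inj₁ p

  private
    Crossing⇒disjoint : Crossing e f → (lo e ≢ lo f × lo e ≢ hi f) × (hi e ≢ lo f × hi e ≢ hi f)
    Crossing⇒disjoint (inj₁ (p , q , r)) =
      (Fin.<⇒≢ p , Fin.<⇒≢ (Fin.<-trans p (Fin.<-trans q r))) , (Fin.<⇒≢ q ∘ sym , Fin.<⇒≢ r)
    Crossing⇒disjoint (inj₂ (p , q , r)) =
      (Fin.<⇒≢ p ∘ sym , Fin.<⇒≢ q) , (Fin.<⇒≢ (Fin.<-trans p (Fin.<-trans q r)) ∘ sym , Fin.<⇒≢ r ∘ sym)

  -- Crossing edges have four distinct ends, so the two edges alone form two separate components,
  -- and these interleave.
  Crossing⇒¬Noncrossing : Crossing e f → ¬ Noncrossing (⁅ f ⁆ ∪ ⁅ e ⁆)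
  Crossing⇒¬Noncrossing {e} {f} cr nc with Crossing⇒disjoint {e} {f} cr
  ... | (a , b) , (c , d) = contra cr
    where
    lo-e≁lo-f : ¬ Connected (⁅ f ⁆ ∪ ⁅ e ⁆) (lo e) (lo f)
    lo-e≁lo-f p with Connected-∪⁅⁆⁻ {⁅ f ⁆} {e} p
    ... | inj₁ q              = a (Connected-⁅⁆ q a b)
    ... | inj₂ (inj₁ (_ , q)) = c (Connected-⁅⁆ q c d)
    ... | inj₂ (inj₂ (q , _)) = lo≢hi e (Connected-⁅⁆ q a b)

    e~ : Connected (⁅ f ⁆ ∪ ⁅ e ⁆) (lo e) (hi e)
    e~ = ∈⇒Connected (∈∪⁅⁆ʳ ⁅ f ⁆ e)

    f~ : Connected (⁅ f ⁆ ∪ ⁅ e ⁆) (lo f) (hi f)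
    f~ = ∈⇒Connected (∈∪⁅⁆ˡ e (x∈⁅x⁆ f))

    contra : ¬ Crossing e f
    contra (inj₁ (p , q , r)) = nc _ _ _ _ (p , q , r , e~ , f~ , lo-e≁lo-f)
    contra (inj₂ (p , q , r)) = nc _ _ _ _ (p , q , r , f~ , e~ , lo-e≁lo-f ∘ Connected-sym)

  ⁅⁆-Noncrossing : ∀ f → Noncrossing ⁅ f ⁆
  ⁅⁆-Noncrossing f = NoncrossingEdges⇒Noncrossing λ g h g∈ h∈ → contra (x∈⁅y⁆⇒x≡y f g∈) (x∈⁅y⁆⇒x≡y f h∈)
    where
    contra : ∀ {g h} → g ≡ f → h ≡ f → ¬ Crossing g h
    contra refl refl = ¬Crossing-refl {f}

  -- The hypothesis on the order, applied to the bond of a single edge f.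
  least-crosses-nothing : Least (E x) e → f ∈ E x → ¬ Crossing e f
  least-crosses-nothing {x} {e} {f} (e∈ , e⊴) f∈ cr = Crossing⇒¬Noncrossing {e} {f} cr
    (Noncrossing-cong (≈ᶜ-trans inducedBond-≈ᶜ (∪⁅⁆-cong-≈ᶜ inducedBond-≈ᶜ))
      (induced-noncrossing H x e (H≤x , λ { refl → e∉H e∈ })
        (x∈p∧x∉q⇒x∈p─q e∈ e∉H , λ g g∈ → e⊴ g (p─q⊆p (E x) (E H) g∈))))
    where
    H : NoncrossingBond
    H = inducedNC ⁅ f ⁆ (⁅⁆-Noncrossing f)
    H≤x : H ≤ x
    H≤x = inducedBond-least (isBond x) λ g∈ → subst (_∈ E x) (sym (x∈⁅y⁆⇒x≡y f g∈)) f∈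
    e∉H : e ∉ E H
    e∉H e∈H = let (a , b) , _ = Crossing⇒disjoint {e} {f} cr in
      lo≢hi e (Connected-⁅⁆ (∈-inducedBond⁻ {F = ⁅ f ⁆} e∈H) a b)

  -- e lies in no broken circuit of x, being the least edge.
  IsNoncrossingNBC-cone : Least (E x) e → IsNoncrossingNBC (E x) S → IsNoncrossingNBC (E x) (S ∪ ⁅ e ⁆)
  IsNoncrossingNBC-cone {x} {e} {S} l@(e∈x , e⊴) ((S⊆x , ∄B) , nc) = (S⁺⊆x , ∄B⁺) , nc⁺
    where
    S⁺⊆x : S ∪ ⁅ e ⁆ ⊆ E x
    S⁺⊆x f∈ = [ S⊆x , (λ { refl → e∈x }) ]′ (∈∪⁅⁆⁻ {S = S} f∈)

    ∄B⁺ : ¬ (∃[ B ] (IsBrokenCircuit (E x) B × B ⊆ S ∪ ⁅ e ⁆))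
    ∄B⁺ (B , bc@(C , cyc , C⊆x , c , (c∈C , c⊴) , refl) , B⊆S⁺) with e ∈? B
    ... | yes e∈B = let e∈C , e≢c = ∈-⁻ {S = C} e∈B in
      e≢c (⊴.antisym (e⊴ c (C⊆x c∈C)) (c⊴ e e∈C))
    ... | no e∉B = ∄B (B , bc , λ f∈B →
      [ (λ f∈S → f∈S) , (λ { refl → ⊥-elim (e∉B f∈B) }) ]′ (∈∪⁅⁆⁻ {S = S} (B⊆S⁺ f∈B)))

    nc⁺ : NoncrossingEdges (S ∪ ⁅ e ⁆)
    nc⁺ f g f∈ g∈ cr with ∈∪⁅⁆⁻ {S = S} f∈ | ∈∪⁅⁆⁻ {S = S} g∈
    ... | inj₁ f∈S  | inj₁ g∈S  = nc f g f∈S g∈S cr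
    ... | inj₂ refl | _         = least-crosses-nothing {x} l (S⁺⊆x g∈) cr
    ... | _         | inj₂ refl = least-crosses-nothing {x} l (S⁺⊆x f∈) (Crossing-sym {f} {g} cr)

  module Extension {x y e} (x<y : x < y) (l : Least (E y ─ E x) e) where

    extension : NoncrossingBond
    extension = inducedBond (E x ∪ ⁅ e ⁆) Refinement., [ inducedBond-IsBond , induced-noncrossing x y e x<y l ]

    private
      e∈y×e∉x : e ∈ E y × e ∉ E x
      e∈y×e∉x = ∈─⁻ (E y) (E x) (proj₁ l)

    ∈-extension : e ∈ E extension
    ∈-extension = inducedBond-⊇ (∈∪⁅⁆ʳ (E x) e)

    <-extension : x < extension
    <-extension = (λ f∈ → inducedBond-⊇ (∈∪⁅⁆ˡ e f∈)) ,
                  λ x≡ → proj₂ e∈y×e∉x (subst (λ z → e ∈ E z) (sym x≡) ∈-extension)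

    extension-≤ : extension ≤ y
    extension-≤ = inducedBond-least (isBond y) λ f∈ →
      [ proj₁ x<y , (λ { refl → proj₁ e∈y×e∉x }) ]′ (∈∪⁅⁆⁻ {S = E x} f∈)

    cc-extension : cc (E x) ≡ suc (cc (E extension))
    cc-extension = trans (cc-∪⁅⁆ (proj₂ e∈y×e∉x ∘ bond-∈ (isBond x)))
                         (cong suc (cc-cong (≈ᶜ-sym inducedBond-≈ᶜ)))

  open Extension

  least-new : x < y → ∃ (Least (E y ─ E x))
  least-new {x} {y} x<y = least (E y ─ E x) (<⇒─-nonempty {x} {y} x<y)

  toward : x < y → ∃[ z ] (z ≤ y × cc (E x) ≡ suc (cc (E z)))
  toward {x} {y} x<y with least-new {x} {y} x<y
  ... | e , l = extension {x} {y} x<y l , extension-≤ {x} {y} x<y l , cc-extension {x} {y} x<y l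

  -- Repeated extension from `x` toward `y` stays below `y`, loses one component each time and can
  -- stop only at `y`; the number of components bounds how often this happens.
  <-cc : x < y → cc (E y) ℕ.< cc (E x)
  <-cc {x} {y} = go (cc (E x)) refl
    where
    go : ∀ {x} k → cc (E x) ≡ k → x < y → cc (E y) ℕ.< cc (E x)
    go {x} k eq x<y with toward {x} {y} x<y
    ... | z , z≤y , cc≡ with z ≟ y
    ...   | yes refl = ℕ.≤-reflexive (sym cc≡)
    go zero eq x<y | z , z≤y , cc≡ | no z≢y with trans (sym cc≡) eq
    ... | ()
    go (suc k) eq x<y | z , z≤y , cc≡ | no z≢y =
      ℕ.<-trans (go {z} k (ℕ.suc-injective (trans (sym cc≡) eq)) (z≤y , z≢y)) (ℕ.≤-reflexive (sym cc≡))

  ≤∧cc≡⇒≡ : x ≤ y → cc (E x) ≡ cc (E y) → x ≡ y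
  ≤∧cc≡⇒≡ {x} {y} x≤y eq with x ≟ y
  ... | yes x≡y = x≡y
  ... | no  x≢y = ⊥-elim (ℕ.<-irrefl (sym eq) (<-cc {x} {y} (x≤y , x≢y)))

  cc-suc⇒⋖ : x ≤ y → cc (E x) ≡ suc (cc (E y)) → x ⋖ y
  cc-suc⇒⋖ {x} {y} x≤y eq =
    (x≤y , λ { refl → ℕ.1+n≢n (sym eq) }) ,
    λ z (x<z , z<y) → ℕ.<-irrefl (sym eq)
      (ℕ.≤-<-trans (<-cc {z} {y} z<y) (<-cc {x} {z} x<z))

  -- The extension lies strictly above `x` and below `y`, where a cover leaves no room. So the lower
  -- end of a cover and its label determine the upper end.
  ⋖-extension : (x⋖y : x ⋖ y) (l : Least (E y ─ E x) e) → extension {x} {y} (proj₁ x⋖y) l ≡ y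
  ⋖-extension {x} {y} (x<y , none) l with extension {x} {y} x<y l ≟ y
  ... | yes z≡y = z≡y
  ... | no  z≢y = ⊥-elim (none _ (<-extension {x} {y} x<y l , extension-≤ {x} {y} x<y l , z≢y))

  ⋖⇒inducedBond : x ⋖ y → Least (E y ─ E x) e → inducedBond (E x ∪ ⁅ e ⁆) ≡ E y
  ⋖⇒inducedBond {x} {y} x⋖y l = cong E (⋖-extension {x} {y} x⋖y l)

  ⋖⇒cc : x ⋖ y → cc (E x) ≡ suc (cc (E y))
  ⋖⇒cc {x} {y} x⋖y with least-new {x} {y} (proj₁ x⋖y)
  ... | e , l = trans (cc-extension {x} {y} (proj₁ x⋖y) l) (cong (suc ∘ cc ∘ E) (⋖-extension {x} {y} x⋖y l))

  extension-⋖ : (x<y : x < y) (l : Least (E y ─ E x) e) → x ⋖ extension {x} {y} x<y l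
  extension-⋖ {x} {y} x<y l = cc-suc⇒⋖ (proj₁ (<-extension {x} {y} x<y l)) (cc-extension {x} {y} x<y l)

  label : ∀ x y → .(x ⋖ y) → Edge
  label = minimumLabeling

  label-Least : ∀ x y .(x⋖y : x ⋖ y) → Least (E y ─ E x) (label x y x⋖y)
  label-Least x y x⋖y = minEdge-Least (E y ─ E x) (<⇒─-nonempty {x} {y} (proj₁ x⋖y))

-- Abstract minimum labelings: the EL-property and the exchange of chains.

All⇒Linked-∷ : ∀ {A : Set} {R : Rel A 0ℓ} {x xs} → All (R x) xs → Linked R xs → Linked R (x ∷ xs)
All⇒Linked-∷ []       []  = [-]
All⇒Linked-∷ (r ∷ _) rs  = r ∷ rs

module _ (P : FinitePoset) where
  open FinitePoset P

  elems : ∀ {x y} → SaturatedChain P x y → List Carrier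
  elems ⟨ x ⟩        = x ∷ []
  elems (x ⋖⟨ _ ⟩ c) = x ∷ elems c

-- The sets E x play the role of the edge sets of noncrossing bonds; toward is
-- the hypothesis that adding the least missing element stays inside the poset.
record MinimumLabeling (P : FinitePoset) {m : ℕ} (_⊴_ : Rel (Fin m) 0ℓ)
                       (ℓ : EdgeLabeling P (Fin m)) : Set where
  open FinitePoset P
  field
    E             : Carrier → Subset m
    E-mono        : ∀ {x y} → x ≤ y → E x ⊆ E y
    ℓ-∈           : ∀ x y .(x⋖y : x ⋖ y) → ℓ x y x⋖y ∈ E y
    ℓ-∉           : ∀ x y .(x⋖y : x ⋖ y) → ℓ x y x⋖y ∉ E x
    ℓ-⊴           : ∀ x y .(x⋖y : x ⋖ y) {e} → e ∈ E y → e ∉ E x → ℓ x y x⋖y ⊴ e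
    ⋖-determined  : ∀ x y z .(x⋖y : x ⋖ y) .(x⋖z : x ⋖ z) → ℓ x y x⋖y ≡ ℓ x z x⋖z → y ≡ z
    toward        : ∀ {x y} → x < y → ∃[ z ] (x ⋖ z × z ≤ y × ∃[ e ] (e ∈ E z × e ∉ E x ×
                      (∀ {f} → f ∈ E y → f ∉ E x → e ⊴ f)))
    corank        : Carrier → ℕ
    ⋖⇒corank      : ∀ {x y} → x ⋖ y → corank x ≡ suc (corank y)
    corank⇒⋖      : ∀ {x y} → x ≤ y → corank x ≡ suc (corank y) → x ⋖ y

module MinimumLabeledPoset
  (P : FinitePoset) {m : ℕ} (_⊴_ : Rel (Fin m) 0ℓ) (⊴-isTotalOrder : IsTotalOrder _≡_ _⊴_)
  (ℓ : EdgeLabeling P (Fin m)) (minimumLabeling : MinimumLabeling P _⊴_ ℓ)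
  where
  open FinitePoset P
  open ToStrict _≡_ _⊴_ using () renaming (_<_ to _◁_)
  open MinimumLabeling minimumLabeling

  private
    module ≤ = IsDecPartialOrder isDecPartialOrder
    module ⊴ = IsTotalOrder ⊴-isTotalOrder

  ◁-isStrictTotalOrder : IsStrictTotalOrder _≡_ _◁_
  ◁-isStrictTotalOrder = ToStrict.<-isStrictTotalOrder₁ _≡_ _⊴_ Fin._≟_ ⊴-isTotalOrder

  private module ◁ = IsStrictTotalOrder ◁-isStrictTotalOrder

  Chain : Carrier → Carrier → Set
  Chain = SaturatedChain P

  word : ∀ {x y} → Chain x y → List (Fin m)
  word = labels P ℓ

  infix 4 _<ˡᵉˣ_
  _<ˡᵉˣ_ : Rel (List (Fin m)) 0ℓ
  _<ˡᵉˣ_ = Lex-< _≡_ _◁_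

  private variable
    x y z w : Carrier
    e f     : Fin m

  ⋖⇒≤ : ∀ x y → .(x ⋖ y) → x ≤ y
  ⋖⇒≤ x y x⋖y = proj₁ (proj₁ (⋖-recompute P x⋖y))

  ⋖⇒≱ : ∀ x y → .(x ⋖ y) → ¬ y ≤ x
  ⋖⇒≱ x y x⋖y y≤x = let (x≤y , x≢y) , _ = ⋖-recompute P x⋖y in x≢y (≤.antisym x≤y y≤x)

  chain-corank : (c : Chain x y) → corank x ≡ chainLength P c ℕ.+ corank y
  chain-corank ⟨ x ⟩ = refl
  chain-corank (x ⋖⟨ x⋖y ⟩ c) = trans (⋖⇒corank (⋖-recompute P x⋖y)) (cong suc (chain-corank c))

  chain-≤ : Chain x y → x ≤ y
  chain-≤ ⟨ x ⟩ = ≤.refl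
  chain-≤ (_⋖⟨_⟩_ x {y} x⋖y c) = ≤.trans (⋖⇒≤ x y x⋖y) (chain-≤ c)

  loop-trivial : (c : Chain x x) → c ≡ ⟨ x ⟩
  loop-trivial ⟨ x ⟩ = refl
  loop-trivial (_⋖⟨_⟩_ x {y} x⋖y c) = ⊥-elim (⋖⇒≱ x y x⋖y (chain-≤ c))

  labels-injective : (c d : Chain x y) → word c ≡ word d → c ≡ d
  labels-injective ⟨ x ⟩ d _ = sym (loop-trivial d)
  labels-injective c@(_ ⋖⟨ _ ⟩ _) ⟨ x ⟩ _ = loop-trivial c
  labels-injective (_⋖⟨_⟩_ x {y} x⋖y c) (_⋖⟨_⟩_ x {z} x⋖z d) eq
    with ⋖-determined x y z x⋖y x⋖z (List.∷-injectiveˡ eq)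
  ... | refl = cong (x ⋖⟨ x⋖y ⟩_) (labels-injective c d (List.∷-injectiveʳ eq))

  labels-new : (c : Chain x y) → All (λ e → e ∈ E y × e ∉ E x) (word c)
  labels-new ⟨ x ⟩ = []
  labels-new (_⋖⟨_⟩_ x {y} x⋖y c) =
    (E-mono (chain-≤ c) (ℓ-∈ x y x⋖y) , ℓ-∉ x y x⋖y) ∷
    All.map (λ (e∈z , e∉y) → e∈z , e∉y ∘ E-mono (⋖⇒≤ x y x⋖y)) (labels-new c)

  -- At the step where `e` enters the chain, `e` competes for the label.
  label-below : (c : Chain x y) → e ∈ E y → e ∉ E x → Any (_⊴ e) (word c)
  label-below ⟨ x ⟩ e∈ e∉ = ⊥-elim (e∉ e∈)
  label-below {e = e} (_⋖⟨_⟩_ x {y} x⋖y c) e∈z e∉x with e ∈? E y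
  ... | yes e∈y = here (ℓ-⊴ x y x⋖y e∈y e∉x)
  ... | no  e∉y = there (label-below c e∈z e∉y)

  increasing-head-⊴ : ∀ {es} → Linked _◁_ (f ∷ es) → Any (_⊴ e) (f ∷ es) → f ⊴ e
  increasing-head-⊴ _ (here f⊴e) = f⊴e
  increasing-head-⊴ l (there any) with Linked⇒AllPairs ◁.trans l | find any
  ... | f◁ ∷ _ | g , g∈ , g⊴e = ⊴.trans (proj₁ (All.lookup f◁ g∈)) g⊴e

  -- Let `e` be the least element of E y missing from E x. Every chain has a label at or before `e`
  -- by `label-below`; in an increasing chain the first label is then at or before `e` too, and so
  -- equals `e`. In any chain the first label is at or after `e`, and equality fixes the next
  -- element, so both uniqueness and lexicographic minimality pass to the rest of the chain.
  el-labeling : IsELLabeling P ℓ _◁_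
  el-labeling {x} {y} = go (corank x) refl
    where
    go : ∀ {x} k → corank x ≡ k → x ≤ y →
         ∃[ c ] Linked _◁_ (word {x} {y} c)
              × (∀ d → Linked _◁_ (word d) → d ≡ c)
              × (∀ d → d ≢ c → word c <ˡᵉˣ word d)
    go {x} k eq x≤y with x ≟ y
    ... | yes refl = ⟨ x ⟩ , [] , (λ d _ → loop-trivial d) , λ d d≢ → ⊥-elim (d≢ (loop-trivial d))
    ... | no  x≢y with toward (x≤y , x≢y)
    ...   | z , x⋖z , z≤y , e , e∈z , e∉x , e⊴ with trans (sym (⋖⇒corank x⋖z)) eq
    go (suc k) eq x≤y | no x≢y | z , x⋖z , z≤y , e , e∈z , e∉x , e⊴ | eq′
      with go {z} k (ℕ.suc-injective eq′) z≤y
    go {x} (suc k) eq x≤y | no x≢y | z , x⋖z , z≤y , e , e∈z , e∉x , e⊴ | eq′ | c , inc , uniq , lex =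
      x ⋖⟨ x⋖z ⟩ c , All⇒Linked-∷ e-first inc , uniq′ , lex′
      where
      ℓ≡e : ℓ x z x⋖z ≡ e
      ℓ≡e = ⊴.antisym (ℓ-⊴ x z x⋖z e∈z e∉x) (e⊴ (E-mono z≤y (ℓ-∈ x z x⋖z)) (ℓ-∉ x z x⋖z))

      e⊴ℓ : ∀ w .(x⋖w : x ⋖ w) → w ≤ y → e ⊴ ℓ x w x⋖w
      e⊴ℓ w x⋖w w≤y = e⊴ (E-mono w≤y (ℓ-∈ x w x⋖w)) (ℓ-∉ x w x⋖w)

      e-first : All (ℓ x z x⋖z ◁_) (word c)
      e-first = All.map (λ {f} (f∈y , f∉z) → subst (_◁ f) (sym ℓ≡e)
        (e⊴ f∈y (f∉z ∘ E-mono (⋖⇒≤ x z x⋖z)) , λ { refl → f∉z e∈z })) (labels-new c)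

      uniq′ : ∀ d → Linked _◁_ (word d) → d ≡ x ⋖⟨ x⋖z ⟩ c
      uniq′ ⟨ _ ⟩ _ = ⊥-elim (x≢y refl)
      uniq′ (_⋖⟨_⟩_ x {w} x⋖w d) inc-d
        with ⋖-determined x w z x⋖w x⋖z (trans (⊴.antisym
               (increasing-head-⊴ inc-d (label-below (x ⋖⟨ x⋖w ⟩ d) (E-mono z≤y e∈z) e∉x))
               (e⊴ℓ w x⋖w (chain-≤ d))) (sym ℓ≡e))
      ... | refl = cong (x ⋖⟨ x⋖z ⟩_) (uniq d (Linked.tail inc-d))

      lex′ : ∀ d → d ≢ x ⋖⟨ x⋖z ⟩ c → ℓ x z x⋖z ∷ word c <ˡᵉˣ word d
      lex′ ⟨ _ ⟩ _ = ⊥-elim (x≢y refl)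
      lex′ (_⋖⟨_⟩_ x {w} x⋖w d) d≢ with ℓ x z x⋖z Fin.≟ ℓ x w x⋖w
      ... | no ℓ≢ = this (subst (_⊴ ℓ x w x⋖w) (sym ℓ≡e) (e⊴ℓ w x⋖w (chain-≤ d)) , ℓ≢)
      ... | yes ℓ≡ with ⋖-determined x z w x⋖z x⋖w ℓ≡
      ...   | refl = next refl (lex d (d≢ ∘ cong (x ⋖⟨ x⋖z ⟩_)))

  -- The exchange property behind shellability: an earlier chain that misses at
  -- most the element z of c.
  Improvement : Chain x y → Carrier → Set
  Improvement {x} {y} c z = ∃[ c′ ] (word {x} {y} c′ <ˡᵉˣ word c ×
                            (∀ {w} → w ∈ˡ elems P c → w ≢ z → w ∈ˡ elems P c′))

  Improvement-∷ : ∀ x {y z} .(x⋖y : x ⋖ y) (c : Chain y z) →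
                  Improvement c w → Improvement (x ⋖⟨ x⋖y ⟩ c) w
  Improvement-∷ x x⋖y c (c′ , c′<c , ⊇) =
    x ⋖⟨ x⋖y ⟩ c′ , next refl c′<c , λ { (here eq) _ → here eq ; (there w∈) w≢ → there (⊇ w∈ w≢) }

  elems-≥ : (c : Chain x y) → w ∈ˡ elems P c → x ≤ w
  elems-≥ ⟨ x ⟩ (here refl) = ≤.refl
  elems-≥ (x ⋖⟨ x⋖y ⟩ c) (here refl) = ≤.refl
  elems-≥ (_⋖⟨_⟩_ x {y} x⋖y c) (there w∈) = ≤.trans (⋖⇒≤ x y x⋖y) (elems-≥ c w∈)

  start-∈ : (c : Chain x y) → x ∈ˡ elems P c
  start-∈ ⟨ x ⟩        = here refl
  start-∈ (x ⋖⟨ _ ⟩ c) = here refl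

  -- The middle element `w` is exchanged for the element `u` reached from `x` by the least element
  -- missing from E x toward `v`. Its label is at most the second label of the descent, hence
  -- smaller than the first; `u ⋖ v` follows because the coranks of `x` and `v` differ by two.
  descent-improvement : ∀ x {w v y} .(x⋖w : x ⋖ w) .(w⋖v : w ⋖ v) (c : Chain v y) →
    ℓ w v w⋖v ◁ ℓ x w x⋖w → Improvement (x ⋖⟨ x⋖w ⟩ (w ⋖⟨ w⋖v ⟩ c)) w
  descent-improvement x {w} {v} x⋖w w⋖v c desc
    with toward {x} {v} (≤.trans (⋖⇒≤ x w x⋖w) (⋖⇒≤ w v w⋖v) , λ { refl → ⋖⇒≱ x w x⋖w (⋖⇒≤ w x w⋖v) })
  ... | u , x⋖u , u≤v , e , e∈u , e∉x , e⊴ =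
    x ⋖⟨ x⋖u ⟩ (u ⋖⟨ u⋖v ⟩ c) ,
    this (◁-respˡ (⊴.trans (ℓ-⊴ x u x⋖u e∈u e∉x) (e⊴ (ℓ-∈ w v w⋖v) (ℓ-∉ w v w⋖v ∘ E-mono (⋖⇒≤ x w x⋖w))))) ,
    λ { (here eq) _ → here eq
      ; (there (here eq)) w≢ → ⊥-elim (w≢ eq)
      ; (there (there w∈)) _ → there (there w∈) }
    where
    u⋖v : u ⋖ v
    u⋖v = corank⇒⋖ u≤v (ℕ.suc-injective (trans (sym (⋖⇒corank x⋖u))
            (trans (⋖⇒corank (⋖-recompute P x⋖w)) (cong suc (⋖⇒corank (⋖-recompute P w⋖v))))))
    ◁-respˡ : ∀ {a} → a ⊴ ℓ w v w⋖v → a ◁ ℓ x w x⋖w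
    ◁-respˡ a⊴ = ⊴.trans a⊴ (proj₁ desc) , λ { refl → proj₂ desc (⊴.antisym (proj₁ desc) a⊴) }

  -- The edge e enters the chain after its first step, although it precedes
  -- the label of that step; hence there is a descent before e enters.
  descent-before : ∀ x {w y} .(x⋖w : x ⋖ w) (c : Chain w y) →
    e ◁ ℓ x w x⋖w → e ∈ E y → e ∉ E w →
    ∃[ z ] (z ∈ˡ elems P c × e ∉ E z × Improvement (x ⋖⟨ x⋖w ⟩ c) z)
  descent-before x x⋖w ⟨ _ ⟩ _ e∈ e∉ = ⊥-elim (e∉ e∈)
  descent-before {e} x {w} x⋖w (_⋖⟨_⟩_ w {v} w⋖v c) e◁ e∈y e∉w with ◁.compare e (ℓ w v w⋖v)
  ... | tri< e◁′ _ _ =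
    let z , z∈ , e∉z , imp = descent-before w w⋖v c e◁′ e∈y
                               (λ e∈v → ◁.irrefl refl (◁-⊴-trans e◁′ (ℓ-⊴ w v w⋖v e∈v e∉w)))
    in  z , there z∈ , e∉z , Improvement-∷ x x⋖w (w ⋖⟨ w⋖v ⟩ c) imp
    where
    ◁-⊴-trans : ∀ {a b c} → a ◁ b → b ⊴ c → a ◁ c
    ◁-⊴-trans (a⊴b , a≢b) b⊴c = ⊴.trans a⊴b b⊴c , λ { refl → a≢b (⊴.antisym a⊴b b⊴c) }
  ... | tri≈ _ refl _  = w , here refl , e∉w , descent-improvement x x⋖w w⋖v c e◁
  ... | tri> _ _ ℓ◁e = w , here refl , e∉w , descent-improvement x x⋖w w⋖v c (◁.trans ℓ◁e e◁)

  -- At the first differing label, let `e` be the label of `d`. It enters `c` only later, so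
  -- `descent-before` applies. The element `z` found there is not in `d`: `e` is missing from E z
  -- but present in every later element of `d`, and `z` lies strictly above the point of divergence.
  exchange : (c d : Chain x y) → word d <ˡᵉˣ word c →
             ∃[ z ] (z ∈ˡ elems P c × z ∉ˡ elems P d × Improvement c z)
  exchange ⟨ x ⟩ ⟨ .x ⟩ (base ())
  exchange ⟨ x ⟩ (_ ⋖⟨ _ ⟩ _) ()
  exchange c@(_ ⋖⟨ _ ⟩ _) ⟨ x ⟩ halt with loop-trivial c
  ... | ()
  exchange (_⋖⟨_⟩_ x {w} x⋖w c) (_⋖⟨_⟩_ x {v} x⋖v d) (next eq d<c)
    with ⋖-determined x v w x⋖v x⋖w eq
  ... | refl = let z , z∈ , z∉ , imp = exchange c d d<c in
    z , there z∈ ,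
    (λ { (here z≡x) → ⋖⇒≱ x w x⋖w (subst (w ≤_) z≡x (elems-≥ c z∈)) ; (there z∈d) → z∉ z∈d }) ,
    Improvement-∷ x x⋖w c imp
  exchange (_⋖⟨_⟩_ x {w} x⋖w c) (_⋖⟨_⟩_ x {v} x⋖v d) (this e◁) =
    let z , z∈ , e∉z , imp = descent-before x x⋖w c e◁ (E-mono (chain-≤ d) e∈v) λ e∈w →
          proj₂ e◁ (⊴.antisym (proj₁ e◁) (ℓ-⊴ x w x⋖w e∈w (ℓ-∉ x v x⋖v)))
    in  z , there z∈ ,
        (λ { (here z≡x) → ⋖⇒≱ x w x⋖w (subst (w ≤_) z≡x (elems-≥ c z∈)) ; (there z∈d) → e∉z (E-mono (elems-≥ d z∈d) e∈v) }) ,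
        imp
    where
    e∈v = ℓ-∈ x v x⋖v

  elems-comparable : (c : Chain x y) → w ∈ˡ elems P c → z ∈ˡ elems P c → w ≤ z ⊎ z ≤ w
  elems-comparable ⟨ x ⟩ (here refl) (here refl) = inj₁ ≤.refl
  elems-comparable c@(_ ⋖⟨ _ ⟩ _) (here refl) z∈ = inj₁ (elems-≥ c z∈)
  elems-comparable c@(_ ⋖⟨ _ ⟩ _) w∈ (here refl) = inj₂ (elems-≥ c w∈)
  elems-comparable (_ ⋖⟨ _ ⟩ c) (there w∈) (there z∈) = elems-comparable c w∈ z∈

  -- The chain is followed while its next element stays below `w`; once `w` is caught within a
  -- cover, it must be one of the two ends.
  elems-saturated : (c : Chain x y) → x ≤ w → w ≤ y →
                    (∀ {z} → z ∈ˡ elems P c → w ≤ z ⊎ z ≤ w) → w ∈ˡ elems P c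
  elems-saturated ⟨ x ⟩ x≤w w≤x _ = here (≤.antisym w≤x x≤w)
  elems-saturated {w = w} (_⋖⟨_⟩_ x {v} x⋖v c) x≤w w≤y cmp with cmp (there (start-∈ c))
  ... | inj₂ v≤w = there (elems-saturated c v≤w w≤y (cmp ∘ there))
  ... | inj₁ w≤v with x ≟ w | w ≟ v
  ...   | yes refl | _        = here refl
  ...   | no  _    | yes refl = there (start-∈ c)
  ...   | no  x≢w  | no  w≢v  =
    ⊥-elim (proj₂ (⋖-recompute P x⋖v) w ((x≤w , x≢w) , (w≤v , w≢v)))

  private
    atEnd : Dec (x ≡ y) → List (Chain x y)
    atEnd (yes refl) = ⟨ _ ⟩ ∷ []
    atEnd (no _)     = []

    via : ∀ x {y} z → Dec (x ⋖ z) → List (Chain z y) → List (Chain x y)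
    via x z (yes x⋖z) cs = map (x ⋖⟨ x⋖z ⟩_) cs
    via x z (no _)    cs = []

  chainsUpTo : ℕ → ∀ x y → List (Chain x y)
  chainsUpTo zero    x y = atEnd (x ≟ y)
  chainsUpTo (suc k) x y = atEnd (x ≟ y) ++
    List.concatMap (λ z → via x z (⋖-dec P x z) (chainsUpTo k z y)) elements

  chainsUpTo-complete : ∀ k (c : Chain x y) → chainLength P c ℕ.≤ k → c ∈ˡ chainsUpTo k x y
  chainsUpTo-complete {y = y} k c p = go k c p
    where
    atEnd-⟨⟩ : ∀ {x} (d : Dec (x ≡ x)) → ⟨ x ⟩ ∈ˡ atEnd d
    atEnd-⟨⟩ (yes refl) = here refl
    atEnd-⟨⟩ (no ¬p)    = ⊥-elim (¬p refl)

    via-⋖ : ∀ {x z} .(x⋖z : x ⋖ z) (d : Dec (x ⋖ z)) {c : Chain z y} {cs} → c ∈ˡ cs →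
            (x ⋖⟨ x⋖z ⟩ c) ∈ˡ via x z d cs
    via-⋖ {x} x⋖z (yes p) c∈ = ∈-map⁺ (x ⋖⟨ p ⟩_) c∈
    via-⋖ {x} x⋖z (no ¬p) c∈ = ⊥-elim (¬p (⋖-recompute P x⋖z))

    go : ∀ {x} k (c : Chain x y) → chainLength P c ℕ.≤ k → c ∈ˡ chainsUpTo k x y
    go {x} zero    ⟨ x ⟩ _ = atEnd-⟨⟩ (x ≟ x)
    go {x} (suc k) ⟨ x ⟩ _ = ∈-++⁺ˡ (atEnd-⟨⟩ (x ≟ x))
    go {x} (suc k) (_⋖⟨_⟩_ x {z} x⋖z c) (s≤s p) = ∈-++⁺ʳ (atEnd (x ≟ y))
      (∈-concatMap⁺ (λ z → via x z (⋖-dec P x z) (chainsUpTo k z y))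
        (lose (elements-complete z) (via-⋖ x⋖z (⋖-dec P x z) (go k c p))))

  chains : ∀ x y → List (Chain x y)
  chains x y = chainsUpTo (corank x) x y

  chains-complete : (c : Chain x y) → c ∈ˡ chains x y
  chains-complete c = chainsUpTo-complete (corank _) c
    (ℕ.≤-trans (ℕ.m≤m+n (chainLength P c) _) (ℕ.≤-reflexive (sym (chain-corank c))))

  private
    chainOrder : ∀ x y → DecTotalOrder 0ℓ 0ℓ 0ℓ
    chainOrder x y = On.decTotalOrder
      (Lex.≤-decTotalOrder (record { isStrictTotalOrder = ◁-isStrictTotalOrder })) (word {x} {y})

    _≟ᶜ_ : (c d : Chain x y) → Dec (c ≡ d)
    c ≟ᶜ d = map′ (labels-injective c d) (cong word) (List.≡-dec Fin._≟_ (word c) (word d))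

    Lex-≤⇒< : ∀ {as bs : List (Fin m)} → Lex.Lex-≤ _≡_ _◁_ as bs → as ≢ bs → as <ˡᵉˣ bs
    Lex-≤⇒< (base _)      ne = ⊥-elim (ne refl)
    Lex-≤⇒< halt          ne = halt
    Lex-≤⇒< (this a◁b)    ne = this a◁b
    Lex-≤⇒< (next refl r) ne = next refl (Lex-≤⇒< r (ne ∘ cong (_ ∷_)))

  sortedChains : ∀ x y → List (Chain x y)
  sortedChains x y = sort (deduplicate _≟ᶜ_ (chains x y))
    where open Sort (chainOrder x y)

  sortedChains-complete : (c : Chain x y) → c ∈ˡ sortedChains x y
  sortedChains-complete {x} {y} c = ∈-resp-↭ (↭-sym (sort-↭ _)) (∈-deduplicate⁺ _≟ᶜ_ (chains-complete c))
    where open Sort (chainOrder x y)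

  -- Sorting gives only the weak order; it is strict here because words determine chains and
  -- repetitions have been removed.
  sortedChains-sorted : ∀ x y → AllPairs (λ c d → word c <ˡᵉˣ word d) (sortedChains x y)
  sortedChains-sorted x y = AllPairs.zipWith
    (λ (c≤d , c≢d) → Lex-≤⇒< c≤d (c≢d ∘ labels-injective _ _))
    ( Linked⇒AllPairs (λ {a b c} → DecTotalOrder.trans (chainOrder x y) {a} {b} {c}) (sort-↗ _)
    , SetoidPerm.Unique-resp-↭ (setoid _) (↭⇒↭ₛ (↭-sym (sort-↭ _))) (deduplicate-! _≟ᶜ_ (chains x y)))
    where open Sort (chainOrder x y)

  -- The lexicographic shelling of the order complex.

  module Shelling (0̂ 1̂ : Carrier) (minimum : Minimum _≤_ 0̂) (maximum : Maximum _≤_ 1̂) where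

    private
      at : Fin (length elements) → Carrier
      at = List.lookup elements

      index : Carrier → Fin (length elements)
      index x = Any.index (elements-complete x)

      at-index : ∀ x → at (index x) ≡ x
      at-index x = sym (Any.lookup-index (elements-complete x))

      onChain? : (c : Chain 0̂ 1̂) → Decidable (λ i → at i ∈ˡ elems P c)
      onChain? c i = Any.any? (at i ≟_) (elems P c)

    chainSet : Chain 0̂ 1̂ → Subset (length elements)
    chainSet c = Vec.tabulate (does ∘ onChain? c)

    private
      ∈-chainSet⁺ : (c : Chain 0̂ 1̂) → w ∈ˡ elems P c → index w ∈ chainSet c
      ∈-chainSet⁺ {w} c w∈ = ∈-tabulate⁺ (onChain? c) (subst (_∈ˡ elems P c) (sym (at-index w)) w∈)

      ∈-chainSet⁻ : (c : Chain 0̂ 1̂) → ∀ {i} → i ∈ chainSet c → at i ∈ˡ elems P c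
      ∈-chainSet⁻ c = ∈-tabulate⁻ (onChain? c)

    -- The usual criterion for a shelling, read off from `exchange`: `c′` serves as an earlier facet
    -- through `chainSet c - i` and may differ from `d`.
    exchange-set : (c d : Chain 0̂ 1̂) → word d <ˡᵉˣ word c →
      ∃[ i ] (i ∈ chainSet c × i ∉ chainSet d ×
              ∃[ c′ ] (word c′ <ˡᵉˣ word c × chainSet c - i ⊆ chainSet c′))
    exchange-set c d d<c with exchange c d d<c
    ... | z , z∈ , z∉ , c′ , c′<c , ⊇ =
      index z , ∈-chainSet⁺ c z∈ , (λ i∈ → z∉ (subst (_∈ˡ elems P d) (at-index z) (∈-chainSet⁻ d i∈))) ,
      c′ , c′<c , λ j∈ → let j∈c , j≢ = ∈-⁻ {S = chainSet c} j∈ in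
        ∈-tabulate⁺ (onChain? c′) (⊇ (∈-chainSet⁻ c j∈c)
          λ at-j≡z → j≢ (lookup-injective elements-unique _ _ (trans at-j≡z (sym (at-index z)))))

    private
      compareˡᵉˣ : (c d : Chain 0̂ 1̂) → c ≢ d → word c <ˡᵉˣ word d ⊎ word d <ˡᵉˣ word c
      compareˡᵉˣ c d c≢d with Lex.<-compare sym ◁.compare (word c) (word d)
      ... | tri< c<d _ _ = inj₁ c<d
      ... | tri> _ _ d<c = inj₂ d<c
      ... | tri≈ _ c≋d _ = ⊥-elim (c≢d (labels-injective c d (Pointwise-≡⇒≡ c≋d)))

    -- Of two distinct chains one is lexicographically earlier, and `exchange-set` yields an index
    -- in the later one that the earlier one lacks.
    chainSet-injective : (c d : Chain 0̂ 1̂) → chainSet c ≡ chainSet d → c ≡ d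
    chainSet-injective c d eq with c ≟ᶜ d
    ... | yes c≡d = c≡d
    ... | no  c≢d with compareˡᵉˣ c d c≢d
    ...   | inj₁ c<d = let i , i∈ , i∉ , _ = exchange-set d c c<d in ⊥-elim (i∉ (subst (i ∈_) (sym eq) i∈))
    ...   | inj₂ d<c = let i , i∈ , i∉ , _ = exchange-set c d d<c in ⊥-elim (i∉ (subst (i ∈_) eq i∈))

    chainSet-face : (c : Chain 0̂ 1̂) → orderComplex P (chainSet c)
    chainSet-face c i∈ j∈ = elems-comparable c (∈-chainSet⁻ c i∈) (∈-chainSet⁻ c j∈)

    chainSet-facet : (c : Chain 0̂ 1̂) → Facet (orderComplex P) (chainSet c)
    chainSet-facet c = chainSet-face c , λ F F-face c⊆F → ⊆-antisym
      (λ {i} i∈F → ∈-tabulate⁺ (onChain? c) (elems-saturated c (minimum _) (maximum _)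
        λ {z} z∈ → subst (λ z → at i ≤ z ⊎ z ≤ at i) (at-index z) (F-face i∈F (c⊆F (∈-chainSet⁺ c z∈)))))
      c⊆F

    -- The chain `Q` is refined upwards from `x`: `lowest` finds an element `u` above `x` that lies
    -- below all elements of `Q` above `x`, with `1̂` as default, and one cover step is taken toward
    -- `u`, so that no element of `Q` is skipped.
    chain-through : {Q : Pred Carrier 0ℓ} → Decidable Q → (∀ {x y} → Q x → Q y → x ≤ y ⊎ y ≤ x) →
                    ∀ x → ∃[ c ] (∀ w → Q w → x ≤ w → w ∈ˡ elems P {x} {1̂} c)
    chain-through {Q} Q? comparable x = go (corank x) x refl
      where
      lowest : ∀ {x} → x < 1̂ → ∀ ws → ∃[ u ] (x < u × (u ≡ 1̂ ⊎ Q u) ×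
                 (∀ w → w ∈ˡ ws → Q w → x < w → u ≤ w))
      lowest x<1̂ [] = 1̂ , x<1̂ , inj₁ refl , λ _ ()
      lowest {x} x<1̂ (v ∷ ws) with lowest x<1̂ ws | Q? v | x <? v
      ... | u , x<u , Qu , u≤ | no ¬Qv | _ = u , x<u , Qu , λ
        { w (here refl) Qw _ → ⊥-elim (¬Qv Qw) ; w (there w∈) → u≤ w w∈ }
      ... | u , x<u , Qu , u≤ | yes _ | no x≮v = u , x<u , Qu , λ
        { w (here refl) _ x<w → ⊥-elim (x≮v x<w) ; w (there w∈) → u≤ w w∈ }
      ... | u , x<u , Qu , u≤ | yes Qv | yes x<v with v≤u⊎u≤v Qu
        where
        v≤u⊎u≤v : u ≡ 1̂ ⊎ Q u → v ≤ u ⊎ u ≤ v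
        v≤u⊎u≤v (inj₁ refl) = inj₁ (maximum v)
        v≤u⊎u≤v (inj₂ Qu)   = comparable Qv Qu
      ...   | inj₁ v≤u = v , x<v , inj₂ Qv , λ
        { w (here refl) _ _ → ≤.refl ; w (there w∈) Qw x<w → ≤.trans v≤u (u≤ w w∈ Qw x<w) }
      ...   | inj₂ u≤v = u , x<u , Qu , λ { w (here refl) _ _ → u≤v ; w (there w∈) → u≤ w w∈ }

      go : ∀ k x → corank x ≡ k → ∃[ c ] (∀ w → Q w → x ≤ w → w ∈ˡ elems P {x} {1̂} c)
      go k x eq with x ≟ 1̂
      ... | yes refl = ⟨ x ⟩ , λ w _ x≤w → here (≤.antisym (maximum w) x≤w)
      ... | no  x≢1̂ with lowest (maximum x , x≢1̂) elements
      ...   | u , x<u , _ , u≤ with toward x<u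
      ...     | z , x⋖z , z≤u , _ with trans (sym (⋖⇒corank x⋖z)) eq
      go (suc k) x eq | no x≢1̂ | u , x<u , _ , u≤ | z , x⋖z , z≤u , _ | eq′
        with go k z (ℕ.suc-injective eq′)
      ... | c , through = x ⋖⟨ x⋖z ⟩ c , through′
        where
        through′ : ∀ w → Q w → x ≤ w → w ∈ˡ x ∷ elems P c
        through′ w Qw x≤w with x ≟ w
        ... | yes x≡w = here (sym x≡w)
        ... | no  x≢w = there (through w Qw (≤.trans z≤u (u≤ w (elements-complete w) Qw (x≤w , x≢w))))

    facet⇒chain : ∀ {F} → Facet (orderComplex P) F → ∃[ c ] F ≡ chainSet c
    facet⇒chain {F} (F-face , F-max) with chain-through
      (λ w → index w ∈? F)
      (λ {x} {y} x∈ y∈ → subst₂ (λ x y → x ≤ y ⊎ y ≤ x) (at-index x) (at-index y) (F-face x∈ y∈)) 0̂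
    ... | c , through = c , sym (F-max (chainSet c) (chainSet-face c) λ {i} i∈F →
      ∈-tabulate⁺ (onChain? c) (through (at i)
        (subst (_∈ F) (lookup-injective elements-unique _ _ (sym (at-index (at i)))) i∈F) (minimum (at i))))

    private
      map-split : ∀ {A B : Set} (f : A → B) {xs ps b rs} → map f xs ≡ ps ++ b ∷ rs →
                  ∃[ ps′ ] ∃[ a ] ∃[ rs′ ] (xs ≡ ps′ ++ a ∷ rs′ × map f ps′ ≡ ps × f a ≡ b)
      map-split f {x ∷ xs} {[]}     refl = [] , x , xs , refl , refl , refl
      map-split f {x ∷ xs} {p ∷ ps} eq with map-split f {xs} {ps} (List.∷-injectiveʳ eq)
      ... | ps′ , a , rs′ , refl , refl , refl =
        x ∷ ps′ , a , rs′ , refl , cong (_∷ map f ps′) (List.∷-injectiveˡ eq) , refl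

      AllPairs-middle : ∀ {A : Set} {R : Rel A 0ℓ} ps {a rs} → AllPairs R (ps ++ a ∷ rs) →
                        All (λ p → R p a) ps × All (R a) rs
      AllPairs-middle []       (r ∷ _)  = [] , r
      AllPairs-middle (p ∷ ps) (r ∷ rs) = let ls , us = AllPairs-middle ps rs in
        All.lookup r (∈-++⁺ʳ ps (here refl)) ∷ ls , us

      <ˡᵉˣ-irrefl : ∀ {as : List (Fin m)} → ¬ as <ˡᵉˣ as
      <ˡᵉˣ-irrefl = Lex.<-irreflexive ◁.irrefl (≡⇒Pointwise-≡ refl)

      <ˡᵉˣ-asym : ∀ {as bs : List (Fin m)} → as <ˡᵉˣ bs → ¬ bs <ˡᵉˣ as
      <ˡᵉˣ-asym = Lex.<-asymmetric sym ◁.<-resp-≈ ◁.asym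

      earlier : ∀ {ps c rs} → sortedChains 0̂ 1̂ ≡ ps ++ c ∷ rs → ∀ d → word d <ˡᵉˣ word c → d ∈ˡ ps
      earlier {ps} {c} {rs} eq d d<c
        with ∈-++⁻ ps (subst (d ∈ˡ_) eq (sortedChains-complete d))
           | AllPairs-middle ps (subst (AllPairs _) eq (sortedChains-sorted 0̂ 1̂))
      ... | inj₁ d∈         | _        = d∈
      ... | inj₂ (here refl) | _       = ⊥-elim (<ˡᵉˣ-irrefl d<c)
      ... | inj₂ (there d∈) | _ , c<rs = ⊥-elim (<ˡᵉˣ-asym d<c (All.lookup c<rs d∈))

    -- `σ` lies in an earlier facet `d` that misses `i`, hence in `chainSet c - i`. This set is
    -- itself a face of the intersection, by way of `c′`, so maximality makes it equal to `σ`.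
    shelling-pure : ∀ {prev F rest} → map chainSet (sortedChains 0̂ 1̂) ≡ prev ++ F ∷ rest →
                    ∀ {σ} → Facet (F ∩⋃ prev) σ → suc ∣ σ ∣ ≡ ∣ F ∣
    shelling-pure eq {σ} ((σ⊆F , σ⊆prev) , σ-max) with map-split chainSet eq
    ... | ps , c , rs , split , refl , refl with find σ⊆prev
    ...   | _ , D∈ , σ⊆D with ∈-map⁻ chainSet D∈
    ...     | d , d∈ , refl
      with exchange-set c d (All.lookup (proj₁ (AllPairs-middle ps
             (subst (AllPairs _) split (sortedChains-sorted 0̂ 1̂)))) d∈)
    ...       | i , i∈c , i∉d , c′ , c′<c , c-i⊆c′ =
      trans (cong (suc ∘ ∣_∣) (sym (σ-max (chainSet c - i)
              ( p─q⊆p (chainSet c) ⁅ i ⁆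
              , lose (∈-map⁺ chainSet (earlier split c′ c′<c)) c-i⊆c′)
              λ j∈σ → x∈p∧x≢y⇒x∈p-y (σ⊆F j∈σ) λ { refl → i∉d (σ⊆D j∈σ) })))
            (∣p-x∣ i∈c)

    shellable : Shellable (orderComplex P)
    shellable = map chainSet (sortedChains 0̂ 1̂) , record
      { distinct = Unique.map⁺ (λ {c} {d} → chainSet-injective c d)
          (AllPairs.map (λ { c<d refl → <ˡᵉˣ-irrefl c<d }) (sortedChains-sorted 0̂ 1̂))
      ; facets   = λ F∈ → let c , _ , eq = ∈-map⁻ chainSet F∈ in
          subst (Facet (orderComplex P)) (sym eq) (chainSet-facet c)
      ; complete = λ facet → let c , eq = facet⇒chain facet in
          subst (_∈ˡ map chainSet (sortedChains 0̂ 1̂)) (sym eq) (∈-map⁺ chainSet (sortedChains-complete c))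
      ; pure     = shelling-pure
      }

-- Decreasing chains and spanning noncrossing NBC sets.

-- For decreasing words this says that the set of labels determines the word, and so the chain.
AllPairs-unique : ∀ {A : Set} {R : Rel A 0ℓ} → Irreflexive _≡_ R → Asymmetric R →
                  ∀ {xs ys} → AllPairs R xs → AllPairs R ys →
                  (∀ {x} → x ∈ˡ xs → x ∈ˡ ys) → (∀ {x} → x ∈ˡ ys → x ∈ˡ xs) → xs ≡ ys
AllPairs-unique irr asym []       []       to from = refl
AllPairs-unique irr asym []       (_ ∷ _)  to from with from (here refl)
... | ()
AllPairs-unique irr asym (_ ∷ _)  []       to from with to (here refl)
... | ()
AllPairs-unique {R = R} irr asym {x ∷ xs} {y ∷ ys} (x≺ ∷ p) (y≺ ∷ q) to from = cong₂ _∷_ x≡y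
  (AllPairs-unique irr asym p q (tail x≺ to (sym x≡y)) (tail y≺ from x≡y))
  where
  x≡y : x ≡ y
  x≡y with to (here refl) | from (here refl)
  ... | here eq  | _        = eq
  ... | there _  | here eq  = sym eq
  ... | there x∈ | there y∈ = ⊥-elim (asym (All.lookup x≺ y∈) (All.lookup y≺ x∈))

  tail : ∀ {a b as bs} → All (R a) as → (∀ {z} → z ∈ˡ a ∷ as → z ∈ˡ b ∷ bs) → b ≡ a →
         ∀ {z} → z ∈ˡ as → z ∈ˡ bs
  tail a≺ sub refl z∈ with sub (there z∈)
  ... | here refl = ⊥-elim (irr refl (All.lookup a≺ z∈))
  ... | there z∈′ = z∈′

module _ {m : ℕ} where

  ∈-fromList⁻ : ∀ (es : List (Fin m)) {e} → e ∈ foldr (λ e S → ⁅ e ⁆ ∪ S) ⊥ es → e ∈ˡ es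
  ∈-fromList⁻ []       e∈ = ⊥-elim (∉⊥ e∈)
  ∈-fromList⁻ (f ∷ es) e∈ with x∈p∪q⁻ ⁅ f ⁆ _ e∈
  ... | inj₁ e∈f  = here (x∈⁅y⁆⇒x≡y f e∈f)
  ... | inj₂ e∈es = there (∈-fromList⁻ es e∈es)

  ∈-fromList⁺ : ∀ {es : List (Fin m)} {e} → e ∈ˡ es → e ∈ foldr (λ e S → ⁅ e ⁆ ∪ S) ⊥ es
  ∈-fromList⁺ (here refl) = x∈p∪q⁺ (inj₁ (x∈⁅x⁆ _))
  ∈-fromList⁺ (there e∈)  = x∈p∪q⁺ (inj₂ (∈-fromList⁺ e∈))

module NCChains
  {n : ℕ} (G : Graph n) (_⊴_ : Rel (GraphNotions.Edge G) 0ℓ) (⊴-isTotalOrder : IsTotalOrder _≡_ _⊴_)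
  (induced-noncrossing : NBCSets.InducedNoncrossing G _⊴_ ⊴-isTotalOrder)
  where
  open OrderedGraph G _⊴_ ⊴-isTotalOrder
  open Graph G
  open Connectivity G
  open NoncrossingSets G
  open NBCSets G _⊴_ ⊴-isTotalOrder
  open NoncrossingBonds G _⊴_ ⊴-isTotalOrder induced-noncrossing
  open Extension
  open FinitePoset NC using (_⋖_; _≟_)

  private
    ⋖-determined : ∀ x y z .(x⋖y : x ⋖ y) .(x⋖z : x ⋖ z) →
                   minimumLabeling x y x⋖y ≡ minimumLabeling x z x⋖z → y ≡ z
    ⋖-determined x y z x⋖y x⋖z eq = E-injective (trans
      (sym (⋖⇒inducedBond {x} {y} (⋖-recompute NC x⋖y) (label-Least x y x⋖y)))
      (trans (cong (λ e → inducedBond (E x ∪ ⁅ e ⁆)) eq)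
        (⋖⇒inducedBond {x} {z} (⋖-recompute NC x⋖z) (label-Least x z x⋖z))))

    toward⋖ : ∀ {x y} → x < y → ∃[ z ] (x ⋖ z × z ≤ y × ∃[ e ] (e ∈ E z × e ∉ E x ×
                (∀ {f} → f ∈ E y → f ∉ E x → e ⊴ f)))
    toward⋖ {x} {y} x<y with least-new {x} {y} x<y
    ... | e , l = extension {x} {y} x<y l , extension-⋖ {x} {y} x<y l , extension-≤ {x} {y} x<y l ,
                  e , ∈-extension {x} {y} x<y l , proj₂ (∈─⁻ (E y) (E x) (proj₁ l)) ,
                  λ f∈ f∉ → proj₂ l _ (x∈p∧x∉q⇒x∈p─q f∈ f∉)

  isMinimumLabeling : MinimumLabeling NC _⊴_ minimumLabeling
  isMinimumLabeling = record
    { E            = E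
    ; E-mono       = λ x≤y {e} → x≤y {e}
    ; ℓ-∈          = λ x y x⋖y → proj₁ (∈─⁻ (E y) (E x) (proj₁ (label-Least x y x⋖y)))
    ; ℓ-∉          = λ x y x⋖y → proj₂ (∈─⁻ (E y) (E x) (proj₁ (label-Least x y x⋖y)))
    ; ℓ-⊴          = λ x y x⋖y e∈ e∉ → proj₂ (label-Least x y x⋖y) _ (x∈p∧x∉q⇒x∈p─q e∈ e∉)
    ; ⋖-determined = ⋖-determined
    ; toward       = λ {x} {y} → toward⋖ {x} {y}
    ; corank       = λ x → cc (E x)
    ; ⋖⇒corank     = λ {x} {y} → ⋖⇒cc {x} {y}
    ; corank⇒⋖     = λ {x} {y} → cc-suc⇒⋖ {x} {y}
    }

  module MLP = MinimumLabeledPoset NC _⊴_ ⊴-isTotalOrder minimumLabeling isMinimumLabeling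
  open MLP using (Chain; word; chain-corank; labels-injective; el-labeling; module Shelling)

  minimal⇒0̂ : ∀ x → Minimal NC x → x ≡ 0̂
  minimal⇒0̂ x min with 0̂ ≟ x
  ... | yes eq  = sym eq
  ... | no  0̂≢x = ⊥-elim (min 0̂ (0̂-minimum x , 0̂≢x))

  maximal⇒≡ : ∀ {1̂} → Maximum _≤_ 1̂ → ∀ x → Maximal NC x → x ≡ 1̂
  maximal⇒≡ {1̂} max x maximal with x ≟ 1̂
  ... | yes eq  = eq
  ... | no  x≢1̂ = ⊥-elim (maximal 1̂ (max x , x≢1̂))

  graded : ∃ (Maximum _≤_) → GradedWithRank NC ρ
  graded (1̂ , max) = record
    { pure         = λ {x} {y} {x′} {y′} mx my mx′ my′ c c′ →
        pure (trans (minimal⇒0̂ x mx) (sym (minimal⇒0̂ x′ mx′)))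
             (trans (maximal⇒≡ {1̂} max y my) (sym (maximal⇒≡ {1̂} max y′ my′))) c c′
    ; rank-minimal = λ {x} min → subst (λ x → ρ x ≡ 0) (sym (minimal⇒0̂ x min))
                                   (trans (cong (n ∸_) cc-⊥) (ℕ.n∸n≡0 n))
    ; rank-cover   = λ {x} {y} x⋖y → let eq = ⋖⇒cc {x} {y} x⋖y in begin
        -- Valid for truncated subtraction because `suc (cc (E y))` equals `cc (E x)`, which is at
        -- most `n`.
        n ∸ cc (E y)             ≡⟨ ℕ.+-∸-assoc 1 (subst (ℕ._≤ n) eq (cc≤n (E x))) ⟩
        suc (n ∸ suc (cc (E y))) ≡⟨ cong (λ k → suc (n ∸ k)) eq ⟨
        suc (n ∸ cc (E x))       ∎
    }
    where
    open ≡-Reasoning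
    pure : ∀ {x y x′ y′} → x ≡ x′ → y ≡ y′ → (c : Chain x y) (c′ : Chain x′ y′) →
           chainLength NC c ≡ chainLength NC c′
    pure {y = y} refl refl c c′ =
      ℕ.+-cancelʳ-≡ (cc (E y)) _ _ (trans (sym (chain-corank c)) (chain-corank c′))

  shellable : ∃ (Maximum _≤_) → Shellable (orderComplex NC)
  shellable (1̂ , max) = Shelling.shellable 0̂ 1̂ 0̂-minimum max

  Spans : NoncrossingBond → Subgraph → Set
  Spans x S = IsNBC (E x) S × NoncrossingEdges S × S ≈ᶜ E x

  Spans⇒ : ∀ x S → Spans x S → IsSpanningNoncrossingNBC (E x) S
  Spans⇒ x S (nbc , nc , S≈x) = (nbc , nc) , ≈ᶜ⇒component≡ S≈x

  ⇒Spans : ∀ x S → IsSpanningNoncrossingNBC (E x) S → Spans x S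
  ⇒Spans x S ((nbc , nc) , eq) = nbc , nc , component≡⇒≈ᶜ eq

  -- As `S` is a spanning NBC set of `y`, every edge of `y` is at or after some element of `S`,
  -- hence after `e`. So `e` is least among all edges of `x`, not only among the new ones, and can
  -- be coned off.
  Spans-extend : ∀ y x S e → y ⋖ x → Least (E x ─ E y) e → (∀ s → s ∈ S → e ◁ s) →
                 Spans y S → Spans x (S ∪ ⁅ e ⁆)
  Spans-extend y x S e y⋖x l e◁S (nbc , nc , S≈y) = proj₁ nnbc⁺ , proj₂ nnbc⁺ , S⁺≈x
    where
    e∈x : e ∈ E x
    e∈x = proj₁ (∈─⁻ (E x) (E y) (proj₁ l))

    Least-x : Least (E x) e
    Least-x = e∈x , λ f f∈x → below f f∈x (f ∈? E y)
      where
      below : ∀ f → f ∈ E x → Dec (f ∈ E y) → e ⊴ f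
      below f f∈x (no f∉y)  = proj₂ l f (x∈p∧x∉q⇒x∈p─q f∈x f∉y)
      below f f∈x (yes f∈y) = let s , s∈S , s⊴f = spanning-NBC-dominates nbc S≈y f∈y in
        ⊴.trans (proj₁ (e◁S s s∈S)) s⊴f

    nnbc⁺ : IsNoncrossingNBC (E x) (S ∪ ⁅ e ⁆)
    nnbc⁺ = IsNoncrossingNBC-cone {x} Least-x (IsNBC-extend (isBond y) (proj₁ (proj₁ y⋖x)) nbc , nc)

    S⁺≈x : (S ∪ ⁅ e ⁆) ≈ᶜ E x
    S⁺≈x = ≈ᶜ-trans (∪⁅⁆-cong-≈ᶜ S≈y)
      (subst ((E y ∪ ⁅ e ⁆) ≈ᶜ_) (⋖⇒inducedBond {y} {x} y⋖x l) (≈ᶜ-sym inducedBond-≈ᶜ))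

  Decreasing-head : ∀ {e es} → Linked (flip _◁_) (e ∷ es) → All (_◁ e) es
  Decreasing-head dec with Linked⇒AllPairs (λ p q → ◁.trans q p) dec
  ... | es◁e ∷ _ = es◁e

  -- Induction up the chain, with `S` holding the labels already passed; the second hypothesis says
  -- that they exceed all labels still to come.
  decreasing-Spans : ∀ {y x} (c : Chain y x) S → Linked (flip _◁_) (word c) →
                     (∀ s g → s ∈ S → g ∈ˡ word c → g ◁ s) → Spans y S → Spans x (S ∪ labelSet c)
  decreasing-Spans {x = x} ⟨ x ⟩ S _ _ spans = subst (Spans x) (sym (∪-identityʳ S)) spans
  decreasing-Spans {x = x} (_⋖⟨_⟩_ y {z} y⋖z c) S dec below spans =
    subst (Spans x) (∪-assoc S ⁅ e ⁆ (labelSet c))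
      (decreasing-Spans c (S ∪ ⁅ e ⁆) (Linked.tail dec) below′
        (Spans-extend y z S e (⋖-recompute NC y⋖z) (label-Least y z y⋖z) (λ s s∈ → below s e s∈ (here refl)) spans))
    where
    e = minimumLabeling y z y⋖z
    below′ : ∀ s g → s ∈ S ∪ ⁅ e ⁆ → g ∈ˡ word c → g ◁ s
    below′ s g s∈ g∈ with ∈∪⁅⁆⁻ {S = S} s∈
    ... | inj₁ s∈S  = below s g s∈S (there g∈)
    ... | inj₂ refl = All.lookup (Decreasing-head dec) g∈

  Spans-0̂ : Spans 0̂ ⊥
  Spans-0̂ = ((λ e∈ → e∈) , λ { (_ , (C , cyc , C⊆⊥ , _) , _) → ∉⊥ (C⊆⊥ (proj₂ (cycle-nonempty cyc))) })
          , (λ e f e∈ → ⊥-elim (∉⊥ e∈)) , (λ c → c) , (λ c → c)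
    where open Cycles G

  decreasing⇒spanning : ∀ x (c : Chain 0̂ x) → Decreasing NC minimumLabeling _◁_ c →
                        IsSpanningNoncrossingNBC (E x) (labelSet c)
  decreasing⇒spanning x c dec = Spans⇒ x (labelSet c)
    (subst (Spans x) (∪-identityˡ (labelSet c))
      (decreasing-Spans c ⊥ dec (λ s g s∈ → ⊥-elim (∉⊥ s∈)) Spans-0̂))

  Spans-⊥ : ∀ y → Spans y ⊥ → y ≡ 0̂
  Spans-⊥ y (_ , _ , ⊥≈y) = E-injective (trans (sym (inducedBond-of-bond (isBond y)))
    (trans (inducedBond-cong (≈ᶜ-sym ⊥≈y)) (inducedBond-of-bond (isBond 0̂))))

  -- The edges left in `S - e` do not cross, so the bond they induce belongs to the poset; deleting
  -- an edge of a forest raises `cc` by exactly one, which makes this bond a lower cover.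
  Spans-remove : ∀ y S e → Least S e → Spans y S →
                 ∃[ z ] (z ⋖ y × Least (E y ─ E z) e × Spans z (S - e))
  Spans-remove y S e l@(e∈S , e⊴) (nbc , nc , S≈y) =
    z , z⋖y ,
    (x∈p∧x∉q⇒x∈p─q (proj₁ nbc e∈S) (IsNBC⇒¬Connected nbc e∈S ∘ ∈-inducedBond⁻) ,
     λ f f∈ → proj₂ (Least-spanning-NBC nbc S≈y l) f (p─q⊆p (E y) (E z) f∈)) ,
    IsNBC-restrict z≤y inducedBond-⊇ (IsNBC-⊆ nbc S-e⊆S) , nc-e , ≈ᶜ-sym inducedBond-≈ᶜ
    where
    S-e⊆S : S - e ⊆ S
    S-e⊆S = p─q⊆p S ⁅ e ⁆
    nc-e : NoncrossingEdges (S - e)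
    nc-e f g f∈ g∈ = nc f g (S-e⊆S f∈) (S-e⊆S g∈)
    z : NoncrossingBond
    z = inducedNC (S - e) (NoncrossingEdges⇒Noncrossing nc-e)
    z≤y : z ≤ y
    z≤y = inducedBond-least (isBond y) (proj₁ nbc ∘ S-e⊆S)
    z⋖y : z ⋖ y
    z⋖y = cc-suc⇒⋖ {z} {y} z≤y (trans (cc-cong inducedBond-≈ᶜ) (trans (IsNBC⇒cc nbc e∈S) (cong suc (cc-cong S≈y))))

  DecreasingTo : NoncrossingBond → Subgraph → Set
  DecreasingTo x S = ∃[ c ] (Linked (flip _◁_) (word {0̂} {x} c) × labelSet c ≡ S)

  -- The chain is built from the top: `d` is the part already found above `y`, and `S` consists of
  -- the edges still to be used, all later in the order than the labels of `d`. Each step moves the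
  -- least edge of `S` to the front of `d`, leaving `S ∪ labelSet d` unchanged.
  build-decreasing : ∀ {x} k y S → ∣ S ∣ ≡ k → Spans y S → (d : Chain y x) → Linked (flip _◁_) (word d) →
                     (∀ s g → s ∈ S → g ∈ˡ word d → g ◁ s) → DecreasingTo x (S ∪ labelSet d)
  build-decreasing {x} k y S ∣S∣ spans d dec below = go (nonempty? S)
    where
    stop : S ≡ ⊥ → y ≡ 0̂ → DecreasingTo x (S ∪ labelSet d)
    stop refl refl = d , dec , sym (∪-identityˡ (labelSet d))

    step : ∀ k → ∣ S ∣ ≡ k → ∀ e → Least S e → ∀ z (z⋖y : z ⋖ y) → Least (E y ─ E z) e → Spans z (S - e) →
           DecreasingTo x (S ∪ labelSet d)
    step zero ∣S∣ e (e∈S , _) _ _ _ _ = ⊥-elim (ℕ.1+n≢0 (trans (∣p-x∣ e∈S) ∣S∣))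
    step (suc k) ∣S∣ e (e∈S , e⊴) z z⋖y new spans′ =
      subst (DecreasingTo x) set≡ (build-decreasing k z (S - e)
        (ℕ.suc-injective (trans (∣p-x∣ e∈S) ∣S∣)) spans′ (z ⋖⟨ z⋖y ⟩ d)
        (All⇒Linked-∷ (All.tabulate λ {g} g∈ → subst (g ◁_) (sym ℓ≡e) (below e g e∈S g∈)) dec) below′)
      where
      ℓ : Edge
      ℓ = minimumLabeling z y z⋖y

      ℓ≡e : ℓ ≡ e
      ℓ≡e = Least-unique (label-Least z y z⋖y) new

      below′ : ∀ s g → s ∈ S - e → g ∈ˡ ℓ ∷ word d → g ◁ s
      below′ s g s∈ (there g∈)  = below s g (proj₁ (∈-⁻ {S = S} s∈)) g∈
      below′ s g s∈ (here g≡ℓ) = let s∈S , s≢e = ∈-⁻ {S = S} s∈ in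
        subst (_◁ s) (sym (trans g≡ℓ ℓ≡e)) (e⊴ s s∈S , λ e≡s → s≢e (sym e≡s))

      set≡ : (S - e) ∪ (⁅ ℓ ⁆ ∪ labelSet d) ≡ S ∪ labelSet d
      set≡ = trans (sym (∪-assoc (S - e) ⁅ ℓ ⁆ (labelSet d)))
        (cong (_∪ labelSet d) (trans (cong (λ f → (S - e) ∪ ⁅ f ⁆) ℓ≡e) (-∪⁅⁆ e∈S)))

    go : Dec (Nonempty S) → DecreasingTo x (S ∪ labelSet d)
    go (no ¬ne) = stop (Empty-unique ¬ne) (Spans-⊥ y (subst (Spans y) (Empty-unique ¬ne) spans))
    go (yes ne) =
      let e , l = least S ne ; z , z⋖y , new , spans′ = Spans-remove y S e l spans in
      step k ∣S∣ e l z z⋖y new spans′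

  spanning⇒∃!decreasing : ∀ x S → IsSpanningNoncrossingNBC (E x) S →
    ∃! _≡_ (λ (c : Chain 0̂ x) → Decreasing NC minimumLabeling _◁_ c × labelSet c ≡ S)
  spanning⇒∃!decreasing x S sp
    with build-decreasing ∣ S ∣ x S refl (⇒Spans x S sp) ⟨ x ⟩ [] (λ _ _ _ ())
  ... | c , dec , eq = c , (dec , labels≡S) , λ {d} (dec-d , eq-d) →
    labels-injective c d (AllPairs-unique (λ { refl → ◁.irrefl refl }) (λ p q → ◁.asym p q)
      (Linked⇒AllPairs (λ p q → ◁.trans q p) dec) (Linked⇒AllPairs (λ p q → ◁.trans q p) dec-d)
      (transfer c d (trans labels≡S (sym eq-d))) (transfer d c (trans eq-d (sym labels≡S))))
    where
    labels≡S : labelSet c ≡ S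
    labels≡S = trans eq (∪-identityʳ S)
    transfer : (c d : Chain 0̂ x) → labelSet c ≡ labelSet d → ∀ {e} → e ∈ˡ word c → e ∈ˡ word d
    transfer c d eq e∈ = ∈-fromList⁻ (word d) (subst (_ ∈_) eq (∈-fromList⁺ e∈))

-- Finite integer sums and toggling an element.

-- An Iverson bracket that unfolds like `monomial`: the coefficient `monomial c j i` is
-- `when (i ℕ.≟ j) c` by definition.
when : ∀ {P : Set} → Dec P → ℤ → ℤ
when d z = if does d then z else 0ℤ

module _ {P : Set} where

  when-yes : (d : Dec P) → P → ∀ {z} → when d z ≡ z
  when-yes (yes _) p = refl
  when-yes (no ¬p) p = ⊥-elim (¬p p)

  when-no : (d : Dec P) → ¬ P → ∀ {z} → when d z ≡ 0ℤ
  when-no (yes p) ¬p = ⊥-elim (¬p p)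
  when-no (no _)  ¬p = refl

  when-0 : (d : Dec P) → when d 0ℤ ≡ 0ℤ
  when-0 (yes _) = refl
  when-0 (no _)  = refl

  when-cong : (d : Dec P) → ∀ {a b} → (P → a ≡ b) → when d a ≡ when d b
  when-cong (yes p) eq = eq p
  when-cong (no _)  eq = refl

  when-neg : (d : Dec P) → ∀ z → when d (ℤ.- z) ≡ ℤ.- when d z
  when-neg (yes _) z = refl
  when-neg (no _)  z = refl

  when-*ʳ : (d : Dec P) → ∀ a b → when d (a ℤ.* b) ≡ when d a ℤ.* b
  when-*ʳ (yes _) a b = refl
  when-*ʳ (no _)  a b = sym (ℤ.*-zeroˡ b)

when-⇔ : ∀ {P Q : Set} (d : Dec P) (d′ : Dec Q) {z} → (P → Q) → (Q → P) → when d z ≡ when d′ z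
when-⇔ (yes p) d′ to from = sym (when-yes d′ (to p))
when-⇔ (no ¬p) d′ to from = sym (when-no d′ (¬p ∘ from))

module _ {A : Set} where

  ∑-cong : ∀ (xs : List A) {f g : A → ℤ} → (∀ x → f x ≡ g x) → ∑ xs f ≡ ∑ xs g
  ∑-cong []       eq = refl
  ∑-cong (x ∷ xs) eq = cong₂ ℤ._+_ (eq x) (∑-cong xs eq)

  ∑-0 : ∀ (xs : List A) {f : A → ℤ} → (∀ {x} → x ∈ˡ xs → f x ≡ 0ℤ) → ∑ xs f ≡ 0ℤ
  ∑-0 []       eq = refl
  ∑-0 (x ∷ xs) eq = cong₂ ℤ._+_ (eq (here refl)) (∑-0 xs (eq ∘ there))

  ∑-+ : ∀ (xs : List A) (f g : A → ℤ) → ∑ xs (λ x → f x ℤ.+ g x) ≡ ∑ xs f ℤ.+ ∑ xs g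
  ∑-+ []       f g = refl
  ∑-+ (x ∷ xs) f g = trans (cong (ℤ._+_ (f x ℤ.+ g x)) (∑-+ xs f g))
                           (interchange (f x) (g x) (∑ xs f) (∑ xs g))

  ∑-neg : ∀ (xs : List A) (f : A → ℤ) → ∑ xs (λ x → ℤ.- f x) ≡ ℤ.- ∑ xs f
  ∑-neg []       f = refl
  ∑-neg (x ∷ xs) f = trans (cong (ℤ._+_ (ℤ.- f x)) (∑-neg xs f)) (sym (ℤ.neg-distrib-+ (f x) (∑ xs f)))

  ∑-++ : ∀ (xs ys : List A) (f : A → ℤ) → ∑ (xs ++ ys) f ≡ ∑ xs f ℤ.+ ∑ ys f
  ∑-++ []       ys f = sym (ℤ.+-identityˡ _)
  ∑-++ (x ∷ xs) ys f = trans (cong (ℤ._+_ (f x)) (∑-++ xs ys f)) (sym (ℤ.+-assoc (f x) _ _))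

  ∑-map : ∀ {B : Set} (h : B → A) xs (f : A → ℤ) → ∑ (map h xs) f ≡ ∑ xs (f ∘ h)
  ∑-map h []       f = refl
  ∑-map h (x ∷ xs) f = cong (ℤ._+_ (f (h x))) (∑-map h xs f)

  ∑-swap : ∀ {B : Set} (xs : List A) (ys : List B) (f : A → B → ℤ) →
           ∑ xs (λ x → ∑ ys (f x)) ≡ ∑ ys (λ y → ∑ xs (λ x → f x y))
  ∑-swap []       ys f = sym (∑-zero ys)
    where
    ∑-zero : ∀ {B : Set} (ys : List B) → ∑ ys (λ _ → 0ℤ) ≡ 0ℤ
    ∑-zero []       = refl
    ∑-zero (y ∷ ys) = trans (ℤ.+-identityˡ _) (∑-zero ys)
  ∑-swap (x ∷ xs) ys f = trans (cong (ℤ._+_ (∑ ys (f x))) (∑-swap xs ys f))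
                               (sym (pointwise ys))
    where
    pointwise : ∀ zs → ∑ zs (λ y → f x y ℤ.+ ∑ xs (λ x → f x y)) ≡
                       ∑ zs (f x) ℤ.+ ∑ zs (λ y → ∑ xs (λ x → f x y))
    pointwise []       = refl
    pointwise (z ∷ zs) = trans (cong (ℤ._+_ (f x z ℤ.+ _)) (pointwise zs)) (interchange (f x z) _ _ _)

  ∑-when : ∀ {P : Set} (d : Dec P) (xs : List A) (f : A → ℤ) → when d (∑ xs f) ≡ ∑ xs (λ x → when d (f x))
  ∑-when (yes _) xs f = refl
  ∑-when (no _)  xs f = sym (∑-0 xs (λ _ → refl))

  ∑-single : ∀ {xs : List A} {a} {f : A → ℤ} → Unique xs → a ∈ˡ xs → (∀ x → x ≢ a → f x ≡ 0ℤ) → ∑ xs f ≡ f a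
  ∑-single {x ∷ xs} {f = f} (x≢ ∷ _) (here refl) f≡0 =
    trans (cong (ℤ._+_ (f x)) (∑-0 xs λ y∈ → f≡0 _ (All.lookup x≢ y∈ ∘ sym))) (ℤ.+-identityʳ (f x))
  ∑-single {x ∷ xs} {a} {f} (x≢ ∷ u) (there a∈) f≡0 =
    trans (cong₂ ℤ._+_ (f≡0 x (All.lookup x≢ a∈)) (∑-single u a∈ f≡0)) (ℤ.+-identityˡ (f a))

  module _ {P : Pred A 0ℓ} (P? : Decidable P) where

    ∑-filter : ∀ xs (f : A → ℤ) → ∑ (filter P? xs) f ≡ ∑ xs (λ x → when (P? x) (f x))
    ∑-filter []       f = refl
    ∑-filter (x ∷ xs) f with P? x
    ... | yes _ = cong (ℤ._+_ (f x)) (∑-filter xs f)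
    ... | no  _ = trans (∑-filter xs f) (sym (ℤ.+-identityˡ _))

    *-length-filter : ∀ c xs → c ℤ.* + length (filter P? xs) ≡ ∑ xs (λ x → when (P? x) c)
    *-length-filter c []       = ℤ.*-zeroʳ c
    *-length-filter c (x ∷ xs) with P? x
    ... | yes _ = trans (ℤ.*-suc c (+ length (filter P? xs))) (cong (ℤ._+_ c) (*-length-filter c xs))
    ... | no  _ = trans (*-length-filter c xs) (sym (ℤ.+-identityˡ _))

-- Sets that differ only at `i` cancel in pairs; describing both by `[ i ]≔` lets the induction
-- follow the recursion of `subsets`.
∑-subsets-toggle : ∀ {m} (i : Fin m) (f : Subset m → ℤ) →
                   (∀ S → f (S [ i ]≔ inside) ≡ ℤ.- f (S [ i ]≔ outside)) → ∑ (subsets m) f ≡ 0ℤ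
∑-subsets-toggle {suc m} i f eq = trans (∑-++ (map (inside ∷_) (subsets m)) _ f)
  (trans (cong₂ ℤ._+_ (∑-map (inside ∷_) (subsets m) f) (∑-map (outside ∷_) (subsets m) f)) (halves i eq))
  where
  halves : ∀ i → (∀ S → f (S [ i ]≔ inside) ≡ ℤ.- f (S [ i ]≔ outside)) →
           ∑ (subsets m) (f ∘ (inside ∷_)) ℤ.+ ∑ (subsets m) (f ∘ (outside ∷_)) ≡ 0ℤ
  halves Fin.zero    eq = trans
    (cong (ℤ._+ ∑ (subsets m) (f ∘ (outside ∷_)))
      (trans (∑-cong (subsets m) (λ S → eq (outside ∷ S))) (∑-neg (subsets m) (f ∘ (outside ∷_)))))
    (ℤ.+-inverseˡ (∑ (subsets m) (f ∘ (outside ∷_))))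
  halves (Fin.suc i) eq = cong₂ ℤ._+_ (∑-subsets-toggle i _ (λ S → eq (inside ∷ S)))
                                      (∑-subsets-toggle i _ (λ S → eq (outside ∷ S)))

module _ {m : ℕ} (S : Subset m) (i : Fin m) where

  ∈-insert⇒ : ∀ {s j} → j ∈ S [ i ]≔ s → j ≢ i → j ∈ S
  ∈-insert⇒ {s} {j} j∈ j≢i = Vec.lookup⇒[]= j S
    (trans (sym (Vec.lookup∘update′ j≢i S s)) (Vec.[]=⇒lookup j∈))

  ∈-insert⇐ : ∀ {s j} → j ∈ S → j ≢ i → j ∈ S [ i ]≔ s
  ∈-insert⇐ {s} {j} j∈ j≢i = Vec.lookup⇒[]= j (S [ i ]≔ s)
    (trans (Vec.lookup∘update′ j≢i S s) (Vec.[]=⇒lookup j∈))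

  insert-inside : S [ i ]≔ inside ≡ (S [ i ]≔ outside) ∪ ⁅ i ⁆
  insert-inside = ⊆-antisym to
    λ j∈ → [ (λ j∈out → from j∈out) , (λ { refl → Vec.[]≔-updates S i }) ]′ (∈∪⁅⁆⁻ {S = S [ i ]≔ outside} j∈)
    where
    to : S [ i ]≔ inside ⊆ (S [ i ]≔ outside) ∪ ⁅ i ⁆
    to {j} j∈ with j Fin.≟ i
    ... | yes refl = ∈∪⁅⁆ʳ (S [ i ]≔ outside) i
    ... | no  j≢i  = ∈∪⁅⁆ˡ i (∈-insert⇐ (∈-insert⇒ j∈ j≢i) j≢i)

    from : S [ i ]≔ outside ⊆ S [ i ]≔ inside
    from {j} j∈ with j Fin.≟ i
    ... | yes refl = Vec.[]≔-updates S i
    ... | no  j≢i  = ∈-insert⇐ (∈-insert⇒ j∈ j≢i) j≢i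

∣insert∣ : ∀ {m} (S : Subset m) i → ∣ S [ i ]≔ inside ∣ ≡ suc ∣ S [ i ]≔ outside ∣
∣insert∣ (_       Vec.∷ S) Fin.zero    = refl
∣insert∣ (inside  Vec.∷ S) (Fin.suc i) = cong suc (∣insert∣ S i)
∣insert∣ (outside Vec.∷ S) (Fin.suc i) = ∣insert∣ S i

-- The Möbius function and the characteristic polynomial.

module MöbiusFunction
  {n : ℕ} (G : Graph n) (_⊴_ : Rel (GraphNotions.Edge G) 0ℓ) (⊴-isTotalOrder : IsTotalOrder _≡_ _⊴_)
  (induced-noncrossing : NBCSets.InducedNoncrossing G _⊴_ ⊴-isTotalOrder)
  where
  open OrderedGraph G _⊴_ ⊴-isTotalOrder
  open Graph G
  open Connectivity G
  open NoncrossingSets G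
  open NBCSets G _⊴_ ⊴-isTotalOrder
  open NoncrossingBonds G _⊴_ ⊴-isTotalOrder induced-noncrossing
  open FinitePoset NC using (_≟_; _≤?_; _<?_; elements; elements-complete; elements-unique; <-wellFounded)
  open Möbius NC 0̂ using (μ-0̂; μ-rec)
  open ≡-Reasoning

  ranked? : ∀ k x S → Dec (∣ S ∣ ≡ k × IsNoncrossingNBC (E x) S)
  ranked? k x S = (∣ S ∣ ℕ.≟ k) ×-dec isNoncrossingNBC? (E x) S

  IsNoncrossingNBC-⊆ : ∀ {X S S′} → IsNoncrossingNBC X S → S′ ⊆ S → IsNoncrossingNBC X S′
  IsNoncrossingNBC-⊆ (nbc , nc) S′⊆S = IsNBC-⊆ nbc S′⊆S , λ e f e∈ f∈ → nc e f (S′⊆S e∈) (S′⊆S f∈)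

  closure : ∀ X S → IsNoncrossingNBC X S → NoncrossingBond
  closure X S (_ , nc) = inducedNC S (NoncrossingEdges⇒Noncrossing nc)

  module _ x S (nnbc : IsNoncrossingNBC (E x) S) where

    closure-≤ : closure (E x) S nnbc ≤ x
    closure-≤ = inducedBond-least (isBond x) (proj₁ (proj₁ nnbc))

    closure-ranked : ∣ S ∣ ≡ ρ (closure (E x) S nnbc) × IsNoncrossingNBC (E (closure (E x) S nnbc)) S
    closure-ranked = trans (IsNBC⇒∣∣ (proj₁ nnbc)) (cong (n ∸_) (sym (cc-cong inducedBond-≈ᶜ))) ,
      IsNBC-restrict closure-≤ inducedBond-⊇ (proj₁ nnbc) , proj₂ nnbc

    -- The closure of `S` lies below `y`, and the forest formula with ∣S∣ = ρ y gives both the same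
    -- number of components.
    closure-unique : ∀ y → ∣ S ∣ ≡ ρ y → IsNoncrossingNBC (E y) S → y ≡ closure (E x) S nnbc
    closure-unique y ∣S∣ (nbc , _) = sym (≤∧cc≡⇒≡ {closure (E x) S nnbc} {y}
      (inducedBond-least (isBond y) (proj₁ nbc))
      (trans (cc-cong inducedBond-≈ᶜ) (ℕ.+-cancelˡ-≡ ∣ S ∣ _ _ (begin
        ∣ S ∣ ℕ.+ cc S              ≡⟨ IsNBC⇒∣∣+cc nbc ⟩
        n                           ≡⟨ ℕ.m∸n+n≡m (cc≤n (E y)) ⟨
        n ∸ cc (E y) ℕ.+ cc (E y)   ≡⟨ cong (ℕ._+ cc (E y)) ∣S∣ ⟨
        ∣ S ∣ ℕ.+ cc (E y)          ∎))))

  -- The only nonzero term is the one at the closure of S.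
  count-closures : ∀ x S c →
    ∑ elements (λ y → when (y ≤? x) (when (ranked? (ρ y) y S) c)) ≡ when (isNoncrossingNBC? (E x) S) c
  count-closures x S c = by-cases (isNoncrossingNBC? (E x) S)
    where
    term : NoncrossingBond → ℤ
    term y = when (y ≤? x) (when (ranked? (ρ y) y S) c)

    by-cases : (d : Dec (IsNoncrossingNBC (E x) S)) → ∑ elements term ≡ when d c
    by-cases (yes nnbc) = trans
      (∑-single elements-unique (elements-complete y₀) λ y y≢y₀ →
        trans (when-cong (y ≤? x) λ _ → when-no (ranked? (ρ y) y S)
                λ (∣S∣ , nnbc-y) → y≢y₀ (closure-unique x S nnbc y ∣S∣ nnbc-y))
              (when-0 (y ≤? x)))
      (trans (when-yes (y₀ ≤? x) (closure-≤ x S nnbc))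
             (when-yes (ranked? (ρ y₀) y₀ S) (closure-ranked x S nnbc)))
      where
      y₀ = closure (E x) S nnbc
    by-cases (no ¬nnbc) = ∑-0 elements λ {y} _ →
      trans (when-cong (y ≤? x) λ y≤x → when-no (ranked? (ρ y) y S)
              λ (_ , nbc , nc) → ¬nnbc (IsNBC-extend (isBond y) y≤x nbc , nc))
            (when-0 (y ≤? x))

  ncnbc-∑ : ∀ (g : ℕ → ℤ) k x →
            g k ℤ.* + ncnbc k (E x) ≡ ∑ (subsets size) (λ S → when (ranked? k x S) (g ∣ S ∣))
  ncnbc-∑ g k x = trans (*-length-filter (ranked? k x) (g k) (subsets size))
    (∑-cong (subsets size) λ S → when-cong (ranked? k x S) λ (∣S∣ , _) → cong g (sym ∣S∣))

  -- Pairs (y , S) are counted in two ways. The weight `g` is left free for two uses: signs give the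
  -- Möbius recursion, and signs restricted to one power of t give a coefficient of χ.
  ∑-ncnbc-below : ∀ (g : ℕ → ℤ) x →
    ∑ elements (λ y → when (y ≤? x) (g (ρ y) ℤ.* + ncnbc (ρ y) (E y))) ≡
    ∑ (subsets size) (λ S → when (isNoncrossingNBC? (E x) S) (g ∣ S ∣))
  ∑-ncnbc-below g x = begin
    ∑ elements (λ y → when (y ≤? x) (g (ρ y) ℤ.* + ncnbc (ρ y) (E y)))
      ≡⟨ ∑-cong elements (λ y → cong (when (y ≤? x)) (ncnbc-∑ g (ρ y) y)) ⟩
    ∑ elements (λ y → when (y ≤? x) (∑ (subsets size) λ S → when (ranked? (ρ y) y S) (g ∣ S ∣)))
      ≡⟨ ∑-cong elements (λ y → ∑-when (y ≤? x) (subsets size) _) ⟩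
    ∑ elements (λ y → ∑ (subsets size) λ S → when (y ≤? x) (when (ranked? (ρ y) y S) (g ∣ S ∣)))
      ≡⟨ ∑-swap elements (subsets size) _ ⟩
    ∑ (subsets size) (λ S → ∑ elements λ y → when (y ≤? x) (when (ranked? (ρ y) y S) (g ∣ S ∣)))
      ≡⟨ ∑-cong (subsets size) (λ S → count-closures x S (g ∣ S ∣)) ⟩
    ∑ (subsets size) (λ S → when (isNoncrossingNBC? (E x) S) (g ∣ S ∣)) ∎

  sign : ℕ → ℤ
  sign k = -1ℤ ℤ.^ k

  -- Toggling the least edge of x is a sign-reversing involution.
  ∑-sign-NBC : ∀ {x} → 0̂ < x → ∑ (subsets size) (λ S → when (isNoncrossingNBC? (E x) S) (sign ∣ S ∣)) ≡ 0ℤ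
  ∑-sign-NBC {x} 0̂<x = ∑-subsets-toggle e _ λ S → begin
    when (isNoncrossingNBC? (E x) (S [ e ]≔ inside)) (sign ∣ S [ e ]≔ inside ∣)
      ≡⟨ cong (when (isNoncrossingNBC? (E x) (S [ e ]≔ inside)))
           (trans (cong sign (∣insert∣ S e)) (ℤ.-1*i≡-i (sign ∣ S [ e ]≔ outside ∣))) ⟩
    when (isNoncrossingNBC? (E x) (S [ e ]≔ inside)) (ℤ.- sign ∣ S [ e ]≔ outside ∣)
      ≡⟨ when-⇔ (isNoncrossingNBC? (E x) (S [ e ]≔ inside)) (isNoncrossingNBC? (E x) (S [ e ]≔ outside))
           (λ nnbc → IsNoncrossingNBC-⊆ nnbc (subst (S [ e ]≔ outside ⊆_) (sym (insert-inside S e)) (∈∪⁅⁆ˡ e)))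
           (λ nnbc → subst (IsNoncrossingNBC (E x)) (sym (insert-inside S e)) (IsNoncrossingNBC-cone {x} l nnbc)) ⟩
    when (isNoncrossingNBC? (E x) (S [ e ]≔ outside)) (ℤ.- sign ∣ S [ e ]≔ outside ∣)
      ≡⟨ when-neg (isNoncrossingNBC? (E x) (S [ e ]≔ outside)) _ ⟩
    ℤ.- when (isNoncrossingNBC? (E x) (S [ e ]≔ outside)) (sign ∣ S [ e ]≔ outside ∣) ∎
    where
    least-edge : ∃ (Least (E x))
    least-edge = let e , e∈ = <⇒─-nonempty {0̂} {x} 0̂<x in least (E x) (e , proj₁ (∈─⁻ (E x) ⊥ e∈))
    e : Edge
    e = proj₁ least-edge
    l : Least (E x) e
    l = proj₂ least-edge

  signedNbc : NoncrossingBond → ℤ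
  signedNbc x = sign (ρ x) ℤ.* + ncnbc (ρ x) (E x)

  ρ-0̂ : ρ 0̂ ≡ 0
  ρ-0̂ = trans (cong (n ∸_) cc-⊥) (ℕ.n∸n≡0 n)

  signedNbc-0̂ : signedNbc 0̂ ≡ 1ℤ
  signedNbc-0̂ = begin
    signedNbc 0̂
      ≡⟨ ncnbc-∑ sign (ρ 0̂) 0̂ ⟩
    ∑ (subsets size) (λ S → when (ranked? (ρ 0̂) 0̂ S) (sign ∣ S ∣))
      ≡⟨ ∑-single (subsets-unique size) (∈-subsets ⊥) (λ S S≢⊥ → when-no (ranked? (ρ 0̂) 0̂ S)
           λ (_ , (S⊆⊥ , _) , _) → S≢⊥ (⊆-antisym S⊆⊥ (⊆-min S))) ⟩
    when (ranked? (ρ 0̂) 0̂ ⊥) (sign ∣ ⊥ {size} ∣)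
      ≡⟨ when-yes (ranked? (ρ 0̂) 0̂ ⊥) (trans (∣⊥∣≡0 size) (sym ρ-0̂) , nnbc-⊥) ⟩
    sign ∣ ⊥ {size} ∣
      ≡⟨ cong sign (∣⊥∣≡0 size) ⟩
    1ℤ ∎
    where
    open Cycles G
    nnbc-⊥ : IsNoncrossingNBC (E 0̂) ⊥
    nnbc-⊥ = ((λ e∈ → e∈) , λ { (_ , (C , cyc , C⊆⊥ , _) , _) → ∉⊥ (C⊆⊥ (proj₂ (cycle-nonempty cyc))) })
           , λ e f e∈ → ⊥-elim (∉⊥ e∈)

  signedNbc-rec : ∀ {x} → x ≢ 0̂ → signedNbc x ≡ ℤ.- ∑ elements (λ y → when (y <? x) (signedNbc y))
  signedNbc-rec {x} x≢0̂ = inverseʳ-unique _ _ below+x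
    where
    below+x : ∑ elements (λ y → when (y <? x) (signedNbc y)) ℤ.+ signedNbc x ≡ 0ℤ
    below+x = begin
      ∑ elements (λ y → when (y <? x) (signedNbc y)) ℤ.+ signedNbc x
        ≡⟨ cong (ℤ._+_ (∑ elements (λ y → when (y <? x) (signedNbc y))))
             (trans (∑-single elements-unique (elements-complete x) λ y y≢x → when-no (y ≟ x) y≢x)
                    (when-yes (x ≟ x) refl)) ⟨
      ∑ elements (λ y → when (y <? x) (signedNbc y)) ℤ.+ ∑ elements (λ y → when (y ≟ x) (signedNbc y))
        ≡⟨ ∑-+ elements _ _ ⟨
      ∑ elements (λ y → when (y <? x) (signedNbc y) ℤ.+ when (y ≟ x) (signedNbc y))
        ≡⟨ ∑-cong elements (λ y → ≤-split y (y ≟ x)) ⟩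
      ∑ elements (λ y → when (y ≤? x) (signedNbc y))
        ≡⟨ ∑-ncnbc-below sign x ⟩
      ∑ (subsets size) (λ S → when (isNoncrossingNBC? (E x) S) (sign ∣ S ∣))
        ≡⟨ ∑-sign-NBC {x} (0̂-minimum x , x≢0̂ ∘ sym) ⟩
      0ℤ ∎
      where
      ≤-split : ∀ y → (d : Dec (y ≡ x)) →
                when (y <? x) (signedNbc y) ℤ.+ when d (signedNbc y) ≡ when (y ≤? x) (signedNbc y)
      ≤-split y (yes y≡x) = trans (cong (ℤ._+ signedNbc y) (when-no (y <? x) λ (_ , y≢x) → y≢x y≡x))
        (trans (ℤ.+-identityˡ _) (sym (when-yes (y ≤? x) (subst (y ≤_) y≡x (λ e∈ → e∈)))))
      ≤-split y (no y≢x) = trans (ℤ.+-identityʳ _) (when-⇔ (y <? x) (y ≤? x) proj₁ (_, y≢x))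

  μ≡signedNbc : ∀ x → μ x ≡ signedNbc x
  μ≡signedNbc x = go x (<-wellFounded x)
    where
    go : ∀ x → Acc _<_ x → μ x ≡ signedNbc x
    go x (acc below) = by-cases (x ≟ 0̂)
      where
      by-cases : Dec (x ≡ 0̂) → μ x ≡ signedNbc x
      by-cases (yes x≡0̂) = subst (λ x → μ x ≡ signedNbc x) (sym x≡0̂) (trans μ-0̂ (sym signedNbc-0̂))
      by-cases (no x≢0̂) = begin
        μ x
          ≡⟨ μ-rec x≢0̂ ⟩
        ℤ.- ∑ (filter (_<? x) elements) μ
          ≡⟨ cong ℤ.-_ (∑-filter (_<? x) elements μ) ⟩
        ℤ.- ∑ elements (λ y → when (y <? x) (μ y))
          ≡⟨ cong ℤ.-_ (∑-cong elements λ y → when-cong (y <? x) λ y<x → go y (below y<x)) ⟩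
        ℤ.- ∑ elements (λ y → when (y <? x) (signedNbc y))
          ≡⟨ signedNbc-rec x≢0̂ ⟨
        signedNbc x ∎

  -- Each edge lies in a noncrossing bond, namely the one induced by that edge alone.
  E-maximum : ∀ {1̂} → Maximum _≤_ 1̂ → E 1̂ ≡ ⊤
  E-maximum {1̂} max = ⊆-antisym ⊆⊤ λ {e} _ → max (inducedNC ⁅ e ⁆ (⁅⁆-Noncrossing e)) (inducedBond-⊇ (x∈⁅x⁆ e))

  χ-ncnbc : ∃ (Maximum _≤_) → χ ≗ ncnbcPolynomial
  χ-ncnbc (1̂ , max) i = begin
    ∑ elements (λ y → when (i ℕ.≟ r ∸ ρ y) (μ y))
      ≡⟨ ∑-cong elements (λ y → trans (cong (when (i ℕ.≟ r ∸ ρ y)) (μ≡signedNbc y))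
                                      (when-*ʳ (i ℕ.≟ r ∸ ρ y) (sign (ρ y)) _)) ⟩
    ∑ elements (λ y → weight (ρ y) ℤ.* + ncnbc (ρ y) (E y))
      -- The vacuous condition `y ≤ 1̂` is inserted to reach the form of the double count.
      ≡⟨ ∑-cong elements (λ y → when-yes (y ≤? 1̂) (max y)) ⟨
    ∑ elements (λ y → when (y ≤? 1̂) (weight (ρ y) ℤ.* + ncnbc (ρ y) (E y)))
      ≡⟨ ∑-ncnbc-below weight 1̂ ⟩
    ∑ (subsets size) (λ S → when (isNoncrossingNBC? (E 1̂) S) (weight ∣ S ∣))
      ≡⟨ ∑-cong (subsets size) by-size ⟨
    ∑ (subsets size) (λ S → ∑ (upTo (suc size)) λ k → when (ranked? k 1̂ S) (weight ∣ S ∣))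
      ≡⟨ ∑-swap (upTo (suc size)) (subsets size) _ ⟨
    ∑ (upTo (suc size)) (λ k → ∑ (subsets size) λ S → when (ranked? k 1̂ S) (weight ∣ S ∣))
      ≡⟨ ∑-cong (upTo (suc size)) (λ k → ncnbc-∑ weight k 1̂) ⟨
    ∑ (upTo (suc size)) (λ k → weight k ℤ.* + ncnbc k (E 1̂))
      ≡⟨ ∑-cong (upTo (suc size)) (λ k → trans (sym (when-*ʳ (i ℕ.≟ r ∸ k) (sign k) _))
           (cong (λ X → when (i ℕ.≟ r ∸ k) (sign k ℤ.* + ncnbc k X)) (E-maximum {1̂} max))) ⟩
    ncnbcPolynomial i ∎
    where
    r : ℕ
    r = posetRank NC ρ

    -- The contribution of a set of size k to the coefficient of t^i.
    weight : ℕ → ℤ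
    weight k = when (i ℕ.≟ r ∸ k) (sign k)

    by-size : ∀ S → ∑ (upTo (suc size)) (λ k → when (ranked? k 1̂ S) (weight ∣ S ∣)) ≡
                    when (isNoncrossingNBC? (E 1̂) S) (weight ∣ S ∣)
    by-size S = trans
      -- Only k = ∣S∣ contributes, and ∣S∣ ≤ `size` places it in the range.
      (∑-single (Unique.upTo⁺ (suc size)) (∈-upTo⁺ (s≤s (∣p∣≤n S)))
        λ k k≢ → when-no (ranked? k 1̂ S) λ (∣S∣ , _) → k≢ (sym ∣S∣))
      (when-⇔ (ranked? ∣ S ∣ 1̂ S) (isNoncrossingNBC? (E 1̂) S) proj₂ (refl ,_))

theorem4p4 : ∀ {n : ℕ} (G : Graph n) (_⊴_ : Rel (GraphNotions.Edge G) 0ℓ)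
    (⊴-isTotalOrder : IsTotalOrder _≡_ _⊴_) →
    let open OrderedGraph G _⊴_ ⊴-isTotalOrder in
    ∃ (Maximum _≤_) →
    (∀ H H′ e → H < H′ → Least (E H′ ─ E H) e → Noncrossing (inducedBond (E H ∪ ⁅ e ⁆))) →
    GradedWithRank NC ρ
    × (IsELLabeling NC minimumLabeling _◁_ × Shellable (orderComplex NC))
    × (∀ X (c : SaturatedChain NC 0̂ X) → Decreasing NC minimumLabeling _◁_ c → IsSpanningNoncrossingNBC (E X) (labelSet c))
    × (∀ X S → IsSpanningNoncrossingNBC (E X) S →
    ∃! _≡_ (λ (c : SaturatedChain NC 0̂ X) → Decreasing NC minimumLabeling _◁_ c × labelSet c ≡ S))
    × ((∀ H → μ H ≡ -1ℤ ^ (n ∸ cc (E H)) * + ncnbc (n ∸ cc (E H)) (E H))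
    × χ ≗ ncnbcPolynomial)
theorem4p4 G _⊴_ ⊴-isTotalOrder maximum induced-noncrossing =
  graded maximum , (el-labeling , shellable maximum) , decreasing⇒spanning , spanning⇒∃!decreasing ,
  μ≡signedNbc , χ-ncnbc maximum
  where
  open NCChains G _⊴_ ⊴-isTotalOrder induced-noncrossing
  open MLP using (el-labeling)
  open MöbiusFunction G _⊴_ ⊴-isTotalOrder induced-noncrossing
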